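{- Let $k\ge 2$ be a natural number. (i) Let $f(t)=t^k+at^{k-1}-b$ with $a,b\in\mathbb{Z}$ and $b\ne 0$. Then $f$ admits polysmoothness $\phi(k-1)/(k-1)$. (ii) Let $f(t)=at^k-t+b$ with $a,b\in\mathbb{Z}$ and $ab\ne 0$. Then $f$ admits polysmoothness $\phi(k)/k$.
   Context: $\phi$ denotes Euler's totient function. A polynomial $f\in\mathbb{Z}[t]$ of positive degree admits polysmoothness $\theta$ (for a real $\theta\ge 0$) if there exists a non-constant polynomial $g\in\mathbb{Z}[t]$ such that every irreducible factor of $f(g(t))$ has degree at most $\theta\,(\deg f)(\deg g)$. -}

module Defs where

open import Algebra.Bundles.Raw using (RawRing)
import Algebra.Definitions.RawSemiring
open import Data.Bool.Base using (if_then_else_)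
open import Data.Integer.Base as ℤ using (ℤ; +_; 0ℤ; 1ℤ)
import Data.Integer.Properties as ℤ
open import Data.List.Base using (List; []; _∷_; map; filter; length; applyUpTo)
open import Data.List.Relation.Unary.All using (all?)
open import Data.Nat.Base as ℕ using (ℕ; zero; suc; NonZero; _≥_; s≤s)
open import Data.Nat.Coprimality using (coprime?)
open import Data.Rational.Base as ℚ using (ℚ; 0ℚ)
open import Level using (0ℓ)
open import Relation.Binary.PropositionalEquality using (_≡_)
open import Relation.Nullary.Decidable using (does)

-- A polynomial in ℤ[t] is its list of coefficients, constant term first.
-- Trailing zeros are allowed, so equality in ℤ[t] is _≈_ rather than _≡_.

Poly : Set
Poly = List ℤ

coeff : Poly → ℕ → ℤ
coeff []      _       = 0ℤ
coeff (c ∷ p) zero    = c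
coeff (c ∷ p) (suc n) = coeff p n

infix 4 _≈_
record _≈_ (p q : Poly) : Set where
  constructor mk≈
  field
    coeff-≡ : ∀ n → coeff p n ≡ coeff q n

infixl 6 _+_ _-_
infixl 7 _*_
infix  8 -_
infixr 9 _∘_

_+_ : Poly → Poly → Poly
[]      + q       = q
(c ∷ p) + []      = c ∷ p
(c ∷ p) + (d ∷ q) = (c ℤ.+ d) ∷ (p + q)

-_ : Poly → Poly
- p = map ℤ.-_ p

_-_ : Poly → Poly → Poly
p - q = p + (- q)

_*_ : Poly → Poly → Poly
[]      * q = []
(c ∷ p) * q = map (c ℤ.*_) q + (0ℤ ∷ p * q)

const : ℤ → Poly
const c = c ∷ []

t : Poly
t = 0ℤ ∷ 1ℤ ∷ []

ℤ[t] : RawRing 0ℓ 0ℓ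
ℤ[t] = record
  { Carrier = Poly
  ; _≈_     = _≈_
  ; _+_     = _+_
  ; _*_     = _*_
  ; -_      = -_
  ; 0#      = []
  ; 1#      = const 1ℤ
  }

open Algebra.Definitions.RawSemiring (RawRing.rawSemiring ℤ[t]) public
  using (_^_; _∣_; Irreducible)

-- (f ∘ g)(t) = f(g(t)), by Horner's rule.

_∘_ : Poly → Poly → Poly
[]      ∘ g = []
(c ∷ f) ∘ g = const c + g * (f ∘ g)

-- The zero polynomial is given degree 0. Trailing zeros do not count.

deg : Poly → ℕ
deg []      = 0
deg (c ∷ p) = if does (all? (ℤ._≟ 0ℤ) p) then 0 else suc (deg p)

fromℕ : ℕ → ℚ
fromℕ n = + n ℚ./ 1

-- The exponent θ is a rational number here. Irreducibility is taken in ℤ[t],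
-- so constant prime factors are included; they have degree 0.

record AdmitsPolysmoothness (f : Poly) (θ : ℚ) : Set where
  field
    f-positiveDegree : deg f ℕ.> 0
    θ-nonNegative    : θ ℚ.≥ 0ℚ
    g                : Poly
    g-nonConstant    : deg g ℕ.> 0
    smooth           : ∀ p → Irreducible p → p ∣ (f ∘ g) →
                       fromℕ (deg p) ℚ.≤ θ ℚ.* fromℕ (deg f) ℚ.* fromℕ (deg g)

-- Euler's totient: the number of m with 1 ≤ m ≤ n that are coprime to n.

φ : ℕ → ℕ
φ n = length (filter (λ m → coprime? m n) (applyUpTo suc n))

φ-ratio : (n : ℕ) .{{_ : NonZero n}} → ℚ
φ-ratio n = + φ n ℚ./ n

k≥2⇒k≢0 : ∀ {k} → k ≥ 2 → NonZero k
k≥2⇒k≢0 (s≤s _) = _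

k≥2⇒k-1≢0 : ∀ {k} → k ≥ 2 → NonZero (k ℕ.∸ 1)
k≥2⇒k-1≢0 (s≤s (s≤s _)) = _

{-# OPTIONS --safe #-}
-- In (i) put n = k - 1 and g = b tⁿ - a, which gives f(g) = b ((t g)ⁿ - 1ⁿ);
-- in (ii) put n = k and g = a tᵏ + b, which gives f(g) = a (gᵏ - tᵏ). Both are
-- of the form c (xⁿ - yⁿ) with x and y of degree at most k, so it suffices that
-- tⁿ - 1 splits over ℤ into factors of degree at most φ(n): homogenised and
-- evaluated at (x, y) they have degree at most φ(n) k, and by Gauss's lemma an
-- irreducible polynomial of positive degree is prime, so it divides one of them.
--
-- The factors are built along the prime factorisation of n rather than by the
-- Möbius formula. Let F be a factor of tᵐ - 1 and q prime. If q ∣ m, then F(t^q)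
-- already has degree at most q φ(m) ≤ φ(q m). If q ∤ m, then F divides F(t^q), as
-- the roots of F are permuted by ζ ↦ ζ^s for every s coprime to m, and the
-- quotient has degree at most (q - 1) φ(m) ≤ φ(q m).
module Submission where

-- The substitutions collapse a trinomial to two terms. In (i), f(g) = gⁿ (g + a) - b, and g + a = b
-- tⁿ turns the first term into b (t g)ⁿ; in (ii), f(g) = a gᵏ - (g - b), and g - b = a tᵏ. Either
-- way deg g = n, which cancels the denominator of φ(n)/n, so the target is the integer inequality
-- deg p ≤ φ(n) k. The splitting of tⁿ - 1 is never written as a product. Instead, any predicate
-- that passes from a product to one of its factors, once true of tⁿ - 1, is shown to be true of a
-- divisor of degree at most φ(n); "divisible by p after homogenising" is such a predicate. The
-- obstacle in the induction is that F must divide F(t^q) anew for each new prime q. Stability under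
-- ζ ↦ ζ^s is therefore carried along, for the cofactor of F too: the argument for the quotient
-- F(t^q)/F needs the corresponding quotient of the cofactor, because it is the product of the two
-- that is a geometric sum, congruent to q modulo tᵐ - 1.

module Totient where

  open import Defs using (φ)
  open import Data.Bool.Base using (true; false; if_then_else_)
  open import Data.List.Base using (length; filter; applyUpTo)
  open import Data.Nat.Base
  open import Data.Nat.Coprimality as Coprime using (Coprime; coprime?)
  open import Data.Nat.Divisibility
  open import Data.Nat.Primality
  open import Data.Nat.Properties
  open import Data.Product.Base using (_×_; _,_)
  open import Data.Sum.Base using (_⊎_; inj₁; inj₂)
  open import Function.Base using (_∘_; _$_)
  open import Relation.Binary.PropositionalEquality
    using (_≡_; refl; sym; trans; cong; cong₂; subst)
  open import Relation.Nullary.Decidable using (Dec; yes; no; does; _×-dec_)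
  open import Relation.Nullary.Negation using (¬_; contradiction)
  open import Relation.Unary using (Pred; Decidable)

  coprime-*ʳ : ∀ {s m n} → Coprime s m → Coprime s n → Coprime s (m * n)
  coprime-*ʳ s⊥m s⊥n {d} (d∣s , d∣mn) = s⊥n (d∣s , Coprime.coprime-divisor (λ { (e∣d , e∣m) → s⊥m (∣-trans e∣d d∣s , e∣m) }) d∣mn)

  coprime-*⁻ˡ : ∀ {s m} n → Coprime s (m * n) → Coprime s m
  coprime-*⁻ˡ n s⊥mn (d∣s , d∣m) = s⊥mn (d∣s , ∣m⇒∣m*n n d∣m)

  coprime-*⁻ʳ : ∀ {s n} m → Coprime s (m * n) → Coprime s n
  coprime-*⁻ʳ m s⊥mn (d∣s , d∣n) = s⊥mn (d∣s , ∣n⇒∣m*n m d∣n)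

  prime∤⇒coprime : ∀ {q s} → Prime q → ¬ q ∣ s → Coprime q s
  prime∤⇒coprime q-prime q∤s {d} (d∣q , d∣s) with prime⇒irreducible q-prime d∣q
  ... | inj₁ d≡1 = d≡1
  ... | inj₂ d≡q = contradiction (subst (_∣ _) d≡q d∣s) q∤s

  -- Finite sums and counting

  ∑< : ℕ → (ℕ → ℕ) → ℕ
  ∑< zero    f = 0
  ∑< (suc n) f = f 0 + ∑< n (f ∘ suc)

  ∑<-mono : ∀ n {f g} → (∀ i → i < n → f i ≤ g i) → ∑< n f ≤ ∑< n g
  ∑<-mono zero    f≤g = z≤n
  ∑<-mono (suc n) f≤g = +-mono-≤ (f≤g 0 z<s) (∑<-mono n λ i i<n → f≤g (suc i) (s<s i<n))

  ∑<-cong : ∀ n {f g} → (∀ i → f i ≡ g i) → ∑< n f ≡ ∑< n g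
  ∑<-cong zero    f≗g = refl
  ∑<-cong (suc n) f≗g = cong₂ _+_ (f≗g 0) (∑<-cong n (f≗g ∘ suc))

  ∑<-+ : ∀ n f g → ∑< n (λ i → f i + g i) ≡ ∑< n f + ∑< n g
  ∑<-+ zero    f g = refl
  ∑<-+ (suc n) f g = trans (cong (f 0 + g 0 +_) (∑<-+ n (f ∘ suc) (g ∘ suc))) (interchange (f 0) (g 0) _ _)
    where open import Algebra.Properties.CommutativeSemigroup +-commutativeSemigroup using (interchange)

  ∑<-const : ∀ n c → ∑< n (λ _ → c) ≡ n * c
  ∑<-const zero    c = refl
  ∑<-const (suc n) c = cong (c +_) (∑<-const n c)

  ∑<-split : ∀ m n f → ∑< (m + n) f ≡ ∑< m f + ∑< n (λ i → f (m + i))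
  ∑<-split zero    n f = refl
  ∑<-split (suc m) n f = trans (cong (f 0 +_) (∑<-split m n (f ∘ suc))) (sym (+-assoc (f 0) _ _))

  ∑<-blocks : ∀ m n f → ∑< (m * n) f ≡ ∑< m (λ i → ∑< n (λ j → f (i * n + j)))
  ∑<-blocks zero    n f = refl
  ∑<-blocks (suc m) n f = trans (∑<-split n (m * n) f) (cong (∑< n f +_) (trans
    (∑<-blocks m n (λ i → f (n + i)))
    (∑<-cong m λ i → ∑<-cong n λ j → cong f (sym (+-assoc n (i * n) j)))))

  -- The Iverson bracket: it makes the count in `φ` a sum, so that counts can be compared term by
  -- term.
  [_] : ∀ {p} {P : Set p} → Dec P → ℕ
  [ P? ] = if does P? then 1 else 0

  []-false : ∀ {p} {P : Set p} (P? : Dec P) → ¬ P → [ P? ] ≡ 0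
  []-false (no  _) ¬p = refl
  []-false (yes p) ¬p = contradiction p ¬p

  []-mono : ∀ {p q} {P : Set p} {Q : Set q} (P? : Dec P) (Q? : Dec Q) → (P → Q) → [ P? ] ≤ [ Q? ]
  []-mono (no  _) Q?      P⇒Q = z≤n
  []-mono (yes p) (yes _) P⇒Q = ≤-refl
  []-mono (yes p) (no ¬q) P⇒Q = contradiction (P⇒Q p) ¬q

  []-⊎ : ∀ {p q r} {P : Set p} {Q : Set q} {R : Set r} (P? : Dec P) (Q? : Dec Q) (R? : Dec R) →
         (P → Q ⊎ R) → [ P? ] ≤ [ Q? ] + [ R? ]
  []-⊎ (no  _) Q?      R? f = z≤n
  []-⊎ (yes p) (yes _) R? f = s≤s z≤n
  []-⊎ (yes p) (no ¬q) R? f with f p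
  ... | inj₁ q = contradiction q ¬q
  ... | inj₂ r = []-mono (yes p) R? λ _ → r

  length-filter-applyUpTo : ∀ {p} {P : Pred ℕ p} (P? : Decidable P) f n →
                            length (filter P? (applyUpTo f n)) ≡ ∑< n (λ i → [ P? (f i) ])
  length-filter-applyUpTo P? f zero    = refl
  length-filter-applyUpTo P? f (suc n) with does (P? (f 0))
  ... | true  = cong suc (length-filter-applyUpTo P? (f ∘ suc) n)
  ... | false = length-filter-applyUpTo P? (f ∘ suc) n

  -- Lower bounds for `φ (q * m)`

  φ-∑ : ∀ n → φ n ≡ ∑< n (λ i → [ coprime? (suc i) n ])
  φ-∑ n = length-filter-applyUpTo (λ m → coprime? m n) suc n

  -- Made for blocks of `q` consecutive numbers: a block `i * q + 1, ..., i * q + q` has its single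
  -- multiple of `q` in the last place.
  ∑<-≤last : ∀ n f c → (∀ i → suc i < n → f i ≡ 0) → (∀ i → suc i ≡ n → f i ≤ c) → ∑< n f ≤ c
  ∑<-≤last zero          f c _  _  = z≤n
  ∑<-≤last (suc zero)    f c _  f≤ = ≤-trans (≤-reflexive (+-identityʳ _)) (f≤ 0 refl)
  ∑<-≤last (suc (suc n)) f c f≡ f≤ = ≤-trans (≤-reflexive (cong (_+ ∑< (suc n) (f ∘ suc)) (f≡ 0 (s<s z<s)))) $
    ∑<-≤last (suc n) (f ∘ suc) c (λ i i<n → f≡ (suc i) (s<s i<n)) (λ i i≡n → f≤ (suc i) (cong suc i≡n))

  coprime-shift : ∀ i {j} m → Coprime j m → Coprime (i * m + j) m
  coprime-shift i {j} m j⊥m (d∣im+j , d∣m) = j⊥m (∣m+n∣m⇒∣n d∣im+j (∣n⇒∣m*n i d∣m) , d∣m)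

  -- Coprimality to `m` has period `m`, so each of the `q` blocks of length `m` contributes at least
  -- `φ m`.
  *φ≤∑ : ∀ q m → q * φ m ≤ ∑< (q * m) (λ i → [ coprime? (suc i) m ])
  *φ≤∑ q m = begin
    q * φ m                                                          ≡⟨ cong (q *_) (φ-∑ m) ⟩
    q * ∑< m (λ j → [ coprime? (suc j) m ])                          ≡⟨ ∑<-const q _ ⟨
    ∑< q (λ i → ∑< m (λ j → [ coprime? (suc j) m ]))                 ≤⟨ ∑<-mono q (λ i _ → ∑<-mono m (λ j _ →
        []-mono (coprime? (suc j) m) (coprime? (suc (i * m + j)) m)
          (λ c → subst (λ k → Coprime k m) (+-suc (i * m) j) (coprime-shift i m c)))) ⟩
    ∑< q (λ i → ∑< m (λ j → [ coprime? (suc (i * m + j)) m ]))       ≡⟨ ∑<-blocks q m (λ i → [ coprime? (suc i) m ]) ⟨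
    ∑< (q * m) (λ i → [ coprime? (suc i) m ])                        ∎
    where open ≤-Reasoning

  -- As `q ∣ m`, a number coprime to `m` is coprime to `q` as well, hence to `q * m`.
  *φ≤φ* : ∀ {q m} → Prime q → q ∣ m → q * φ m ≤ φ (q * m)
  *φ≤φ* {q} {m} q-prime q∣m = begin
    q * φ m                                              ≤⟨ *φ≤∑ q m ⟩
    ∑< (q * m) (λ i → [ coprime? (suc i) m ])            ≤⟨ ∑<-mono (q * m) (λ i _ →
        []-mono (coprime? (suc i) m) (coprime? (suc i) (q * m)) λ c → coprime-*ʳ (λ { (d∣i , d∣q) → c (d∣i , ∣-trans d∣q q∣m) }) c) ⟩
    ∑< (q * m) (λ i → [ coprime? (suc i) (q * m) ])      ≡⟨ φ-∑ (q * m) ⟨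
    φ (q * m)                                            ∎
    where open ≤-Reasoning

  -- This is `(q - 1) φ(m) ≤ φ(q m)` without subtraction. A number coprime to `m` is either coprime
  -- to `q * m` or a multiple `suc i * q`; in the latter case `suc i` is coprime to `m`, so there
  -- are at most `φ m` of these.
  *φ≤φ*+φ : ∀ {q} m → Prime q → q * φ m ≤ φ (q * m) + φ m
  *φ≤φ*+φ {q} m q-prime = begin
    q * φ m                                                                  ≤⟨ *φ≤∑ q m ⟩
    ∑< (q * m) (λ i → [ coprime? (suc i) m ])                                ≤⟨ ∑<-mono (q * m) (λ i _ →
        []-⊎ (coprime? (suc i) m) (coprime? (suc i) (q * m)) (multiple? i) (dichotomy i)) ⟩
    ∑< (q * m) (λ i → [ coprime? (suc i) (q * m) ] + [ multiple? i ])        ≡⟨ ∑<-+ (q * m) _ _ ⟩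
    ∑< (q * m) (λ i → [ coprime? (suc i) (q * m) ]) + ∑< (q * m) (λ i → [ multiple? i ])
                                                                             ≡⟨ cong₂ _+_ (φ-∑ (q * m)) (cong (λ n → ∑< n (λ i → [ multiple? i ])) (*-comm m q)) ⟨
    -- The range is now cut into `m` blocks of length `q`, so that each block holds one multiple of
    -- `q`.
    φ (q * m) + ∑< (m * q) (λ i → [ multiple? i ])                           ≡⟨ cong (φ (q * m) +_) (∑<-blocks m q (λ i → [ multiple? i ])) ⟩
    φ (q * m) + ∑< m (λ i → ∑< q (λ j → [ multiple? (i * q + j) ]))          ≤⟨ +-monoʳ-≤ (φ (q * m)) (∑<-mono m λ i _ →
        ∑<-≤last q _ _ (not-last i) (last i)) ⟩
    φ (q * m) + ∑< m (λ i → [ coprime? (suc i) m ])                          ≡⟨ cong (φ (q * m) +_) (φ-∑ m) ⟨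
    φ (q * m) + φ m                                                          ∎
    where
    open ≤-Reasoning

    Multiple : ℕ → Set
    Multiple i = q ∣ suc i × Coprime (suc i) m

    multiple? : ∀ i → Dec (Multiple i)
    multiple? i = (q ∣? suc i) ×-dec coprime? (suc i) m

    dichotomy : ∀ i → Coprime (suc i) m → Coprime (suc i) (q * m) ⊎ Multiple i
    dichotomy i c with q ∣? suc i
    ... | yes q∣i = inj₂ (q∣i , c)
    ... | no  q∤i = inj₁ (coprime-*ʳ (Coprime.sym (prime∤⇒coprime q-prime q∤i)) c)

    not-last : ∀ i j → suc j < q → [ multiple? (i * q + j) ] ≡ 0
    not-last i j 1+j<q = []-false (multiple? (i * q + j)) λ { (q∣ , _) →
      contradiction (∣m+n∣m⇒∣n (subst (q ∣_) (sym (+-suc (i * q) j)) q∣) (n∣m*n i)) (>⇒∤ 1+j<q) }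

    last : ∀ i j → suc j ≡ q → [ multiple? (i * q + j) ] ≤ [ coprime? (suc i) m ]
    last i j 1+j≡q = []-mono (multiple? (i * q + j)) (coprime? (suc i) m) λ { (_ , c) {d} (d∣1+i , d∣m) →
      c (subst (d ∣_) (trans (cong (_+ i * q) (sym 1+j≡q)) (cong suc (+-comm j (i * q)))) (∣m⇒∣m*n q d∣1+i) , d∣m) }

open import Algebra.Bundles using (CommutativeRing)
open import Algebra.Bundles.Raw using (module RawRing)
open import Algebra.Structures using (IsCommutativeRing)
open import Data.Integer.Base as ℤ using (ℤ; +_; -[1+_]; 0ℤ; 1ℤ; -1ℤ)
import Data.Integer.Divisibility.Signed as ℤ∣
import Data.Integer.Properties as ℤ
open import Data.Integer.Tactic.RingSolver using (solve-∀)
open import Data.List.Base using ([]; _∷_; map)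
open import Data.List.Relation.Unary.All using (All; []; _∷_; all?)
open import Data.Maybe.Base as Maybe using (Maybe)
open import Data.Nat.Base as ℕ
  using (ℕ; zero; suc; NonZero; _≤_; _<_; _≥_; _∸_; z≤n; s≤s; z<s; s<s)
open import Data.Nat.Coprimality as ℕ using (Coprime)
import Data.Nat.Divisibility as ℕ
open import Data.Nat.GCD using (module Bézout)
import Data.Nat.ListAction as ℕ
import Data.Nat.Primality as ℕ
import Data.Nat.Primality.Factorisation as ℕ
import Data.Nat.Properties as ℕ
open import Data.Product.Base using (_×_; _,_; ∃; ∃₂)
open import Data.Rational.Base as ℚ using (0ℚ)
import Data.Rational.Properties as ℚ
import Data.Rational.Unnormalised.Base as ℚᵘ
import Data.Rational.Unnormalised.Properties as ℚᵘ
open import Data.Sum.Base as Sum using (_⊎_; inj₁; inj₂)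
open import Defs
open import Function.Base using (_$_) renaming (_∘_ to _⊚_)
open import Level using (0ℓ)
open import Relation.Binary.Bundles using (Setoid)
open import Relation.Binary.PropositionalEquality as ≡
  using (_≡_; _≢_; refl; sym; trans; cong; cong₂; subst; module ≡-Reasoning)
import Relation.Binary.Reasoning.Setoid as SetoidReasoning
open import Relation.Binary.Structures using (IsEquivalence)
open import Relation.Nullary.Decidable using (Dec; yes; no; map′; dec⇒maybe)
open import Relation.Nullary.Negation using (¬_; contradiction)
open import Tactic.RingSolver.Core.AlmostCommutativeRing using (fromCommutativeRing)

open import Algebra.Definitions.RawMagma (RawRing.*-rawMagma ℤ[t]) using (_,_)

open Totient

-- The exponent as a rational number

-- The trailing factor `n` will be the degree of the substituted polynomial; it cancels the
-- denominator of `φ-ratio n`. The computation takes place in unnormalised rationals, where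
-- numerators and denominators multiply literally, whereas `φ-ratio n` itself is a reduced fraction.
fromℕ-≤-φ-ratio : ∀ d n .{{_ : NonZero n}} k → d ≤ φ n ℕ.* k → fromℕ d ℚ.≤ φ-ratio n ℚ.* fromℕ k ℚ.* fromℕ n
fromℕ-≤-φ-ratio d n@(suc n-1) k d≤φk = ℚ.toℚᵘ-cancel-≤ (begin
  ℚ.toℚᵘ (fromℕ d)                                                        ≃⟨ ℚ.toℚᵘ-fromℚᵘ (ℚᵘ.mkℚᵘ (+ d) 0) ⟩
  ℚᵘ.mkℚᵘ (+ d) 0                                                         ≤⟨ ℚᵘ.*≤* numerators ⟩
  ℚᵘ.mkℚᵘ (+ φ n) n-1 ℚᵘ.* ℚᵘ.mkℚᵘ (+ k) 0 ℚᵘ.* ℚᵘ.mkℚᵘ (+ n) 0           ≃⟨ ℚᵘ.*-cong (ℚᵘ.*-cong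
      (ℚ.toℚᵘ-fromℚᵘ (ℚᵘ.mkℚᵘ (+ φ n) n-1)) (ℚ.toℚᵘ-fromℚᵘ (ℚᵘ.mkℚᵘ (+ k) 0))) (ℚ.toℚᵘ-fromℚᵘ (ℚᵘ.mkℚᵘ (+ n) 0)) ⟨
  ℚ.toℚᵘ (φ-ratio n) ℚᵘ.* ℚ.toℚᵘ (fromℕ k) ℚᵘ.* ℚ.toℚᵘ (fromℕ n)          ≃⟨ ℚᵘ.*-cong (ℚ.toℚᵘ-homo-* (φ-ratio n) (fromℕ k)) (ℚᵘ.≃-refl {ℚ.toℚᵘ (fromℕ n)}) ⟨
  ℚ.toℚᵘ (φ-ratio n ℚ.* fromℕ k) ℚᵘ.* ℚ.toℚᵘ (fromℕ n)                    ≃⟨ ℚ.toℚᵘ-homo-* (φ-ratio n ℚ.* fromℕ k) (fromℕ n) ⟨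
  ℚ.toℚᵘ (φ-ratio n ℚ.* fromℕ k ℚ.* fromℕ n)                              ∎)
  where
  open ℚᵘ.≤-Reasoning

  numerators : + d ℤ.* + (n ℕ.* 1 ℕ.* 1) ℤ.≤ (+ φ n ℤ.* + k ℤ.* + n) ℤ.* + 1
  numerators = ≡.subst₂ ℤ._≤_ lhs rhs (ℤ.+≤+ (ℕ.*-monoˡ-≤ n d≤φk))
    where
    lhs : + (d ℕ.* n) ≡ + d ℤ.* + (n ℕ.* 1 ℕ.* 1)
    lhs = trans (ℤ.pos-* d n) (cong (λ m → + d ℤ.* + m) (sym (trans (ℕ.*-identityʳ (n ℕ.* 1)) (ℕ.*-identityʳ n))))
    rhs : + (φ n ℕ.* k ℕ.* n) ≡ (+ φ n ℤ.* + k ℤ.* + n) ℤ.* + 1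
    rhs = trans (ℤ.pos-* (φ n ℕ.* k) n)
      (trans (cong (ℤ._* + n) (ℤ.pos-* (φ n) k)) (sym (ℤ.*-identityʳ _)))

φ-ratio-nonNegative : ∀ n .{{_ : NonZero n}} → φ-ratio n ℚ.≥ 0ℚ
φ-ratio-nonNegative n = ℚ.nonNegative⁻¹ (φ-ratio n) {{ℚ.normalize-nonNeg (φ n) n}}

-- The ring ℤ[t]

open _≈_

infixr 7 _·_
_·_ : ℤ → Poly → Poly
c · p = map (c ℤ.*_) p

coeff-+ : ∀ p q n → coeff (p + q) n ≡ coeff p n ℤ.+ coeff q n
coeff-+ []      q       n       = sym (ℤ.+-identityˡ _)
coeff-+ (c ∷ p) []      n       = sym (ℤ.+-identityʳ _)
coeff-+ (c ∷ p) (d ∷ q) zero    = refl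
coeff-+ (c ∷ p) (d ∷ q) (suc n) = coeff-+ p q n

coeff-‿- : ∀ p n → coeff (- p) n ≡ ℤ.- coeff p n
coeff-‿- []      n       = refl
coeff-‿- (c ∷ p) zero    = refl
coeff-‿- (c ∷ p) (suc n) = coeff-‿- p n

coeff-· : ∀ c p n → coeff (c · p) n ≡ c ℤ.* coeff p n
coeff-· c []      n       = sym (ℤ.*-zeroʳ c)
coeff-· c (d ∷ p) zero    = refl
coeff-· c (d ∷ p) (suc n) = coeff-· c p n

-- The Cauchy product of coefficient sequences. It sees values and not lists, so `*-cong` holds for
-- lists that differ in trailing zeros.
convolve : (ℕ → ℤ) → (ℕ → ℤ) → ℕ → ℤ
convolve f g zero    = f 0 ℤ.* g 0
convolve f g (suc n) = f 0 ℤ.* g (suc n) ℤ.+ convolve (f ⊚ suc) g n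

convolve-cong : ∀ {f f′ g g′} → (∀ n → f n ≡ f′ n) → (∀ n → g n ≡ g′ n) →
                ∀ n → convolve f g n ≡ convolve f′ g′ n
convolve-cong f≗ g≗ zero    = cong₂ ℤ._*_ (f≗ 0) (g≗ 0)
convolve-cong f≗ g≗ (suc n) =
  cong₂ ℤ._+_ (cong₂ ℤ._*_ (f≗ 0) (g≗ (suc n))) (convolve-cong (f≗ ⊚ suc) g≗ n)

convolve-zeroˡ : ∀ g n → convolve (λ _ → 0ℤ) g n ≡ 0ℤ
convolve-zeroˡ g zero    = refl
convolve-zeroˡ g (suc n) = trans (ℤ.+-identityˡ _) (convolve-zeroˡ g n)

coeff-*-suc : ∀ c p q n → coeff ((c ∷ p) * q) (suc n) ≡
              c ℤ.* coeff q (suc n) ℤ.+ coeff (p * q) n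
coeff-*-suc c p q n = trans (coeff-+ (c · q) (0ℤ ∷ p * q) (suc n))
                            (cong (λ x → x ℤ.+ _) (coeff-· c q (suc n)))

coeff-*-zero : ∀ c p q → coeff ((c ∷ p) * q) 0 ≡ c ℤ.* coeff q 0
coeff-*-zero c p q = trans (coeff-+ (c · q) (0ℤ ∷ p * q) 0)
                           (trans (ℤ.+-identityʳ _) (coeff-· c q 0))

coeff-* : ∀ p q n → coeff (p * q) n ≡ convolve (coeff p) (coeff q) n
coeff-* []      q n       = sym (convolve-zeroˡ (coeff q) n)
coeff-* (c ∷ p) q zero    = coeff-*-zero c p q
coeff-* (c ∷ p) q (suc n) = trans (coeff-*-suc c p q n) (cong (λ x → c ℤ.* coeff q (suc n) ℤ.+ x) (coeff-* p q n))

≈-isEquivalence : IsEquivalence _≈_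
≈-isEquivalence = record
  { refl  = mk≈ λ _ → refl
  ; sym   = λ p≈q → mk≈ λ n → sym (coeff-≡ p≈q n)
  ; trans = λ p≈q q≈r → mk≈ λ n → trans (coeff-≡ p≈q n) (coeff-≡ q≈r n)
  }

open IsEquivalence ≈-isEquivalence
  using () renaming (refl to ≈-refl; sym to ≈-sym; trans to ≈-trans)

≈-setoid : Setoid 0ℓ 0ℓ
≈-setoid = record { isEquivalence = ≈-isEquivalence }

∷-cong : ∀ {c d p q} → c ≡ d → p ≈ q → c ∷ p ≈ d ∷ q
∷-cong c≡d p≈q = mk≈ λ { zero → c≡d ; (suc n) → coeff-≡ p≈q n }

≈-tail : ∀ {c d p q} → c ∷ p ≈ d ∷ q → p ≈ q
≈-tail eq = mk≈ (coeff-≡ eq ⊚ suc)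

≈-tail-[] : ∀ {c p} → c ∷ p ≈ [] → p ≈ []
≈-tail-[] eq = mk≈ (coeff-≡ eq ⊚ suc)

0∷[]≈[] : 0ℤ ∷ [] ≈ []
0∷[]≈[] = mk≈ λ { zero → refl ; (suc n) → refl }

+-cong : ∀ {p p′ q q′} → p ≈ p′ → q ≈ q′ → p + q ≈ p′ + q′
+-cong {p} {p′} {q} {q′} p≈ q≈ = mk≈ λ n → begin
  coeff (p + q) n             ≡⟨ coeff-+ p q n ⟩
  coeff p n ℤ.+ coeff q n     ≡⟨ cong₂ ℤ._+_ (coeff-≡ p≈ n) (coeff-≡ q≈ n) ⟩
  coeff p′ n ℤ.+ coeff q′ n   ≡⟨ coeff-+ p′ q′ n ⟨
  coeff (p′ + q′) n           ∎
  where open ≡-Reasoning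

-‿cong : ∀ {p q} → p ≈ q → - p ≈ - q
-‿cong {p} {q} p≈q = mk≈ λ n →
  trans (coeff-‿- p n) (trans (cong ℤ.-_ (coeff-≡ p≈q n)) (sym (coeff-‿- q n)))

*-cong : ∀ {p p′ q q′} → p ≈ p′ → q ≈ q′ → p * q ≈ p′ * q′
*-cong {p} {p′} {q} {q′} p≈ q≈ = mk≈ λ n → begin
  coeff (p * q) n                        ≡⟨ coeff-* p q n ⟩
  convolve (coeff p) (coeff q) n         ≡⟨ convolve-cong (coeff-≡ p≈) (coeff-≡ q≈) n ⟩
  convolve (coeff p′) (coeff q′) n       ≡⟨ coeff-* p′ q′ n ⟨
  coeff (p′ * q′) n                      ∎
  where open ≡-Reasoning

+-assoc : ∀ p q r → (p + q) + r ≈ p + (q + r)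
+-assoc []      q       r       = ≈-refl
+-assoc (c ∷ p) []      r       = ≈-refl
+-assoc (c ∷ p) (d ∷ q) []      = ≈-refl
+-assoc (c ∷ p) (d ∷ q) (e ∷ r) = ∷-cong (ℤ.+-assoc c d e) (+-assoc p q r)

+-comm : ∀ p q → p + q ≈ q + p
+-comm []      []      = ≈-refl
+-comm []      (d ∷ q) = ≈-refl
+-comm (c ∷ p) []      = ≈-refl
+-comm (c ∷ p) (d ∷ q) = ∷-cong (ℤ.+-comm c d) (+-comm p q)

+-identityʳ : ∀ p → p + [] ≈ p
+-identityʳ p = +-comm p []

-‿inverseʳ : ∀ p → p + (- p) ≈ []
-‿inverseʳ []      = ≈-refl
-‿inverseʳ (c ∷ p) = ≈-trans (∷-cong (ℤ.+-inverseʳ c) (-‿inverseʳ p)) 0∷[]≈[]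

-‿inverseˡ : ∀ p → (- p) + p ≈ []
-‿inverseˡ p = ≈-trans (+-comm (- p) p) (-‿inverseʳ p)

module ≈-Reasoning = SetoidReasoning ≈-setoid

+-congˡ : ∀ p {q q′} → q ≈ q′ → p + q ≈ p + q′
+-congˡ p = +-cong (≈-refl {p})

+-congʳ : ∀ p {q q′} → q ≈ q′ → q + p ≈ q′ + p
+-congʳ p q≈ = +-cong q≈ (≈-refl {p})

*-congˡ : ∀ p {q q′} → q ≈ q′ → p * q ≈ p * q′
*-congˡ p = *-cong (≈-refl {p})

*-congʳ : ∀ p {q q′} → q ≈ q′ → q * p ≈ q′ * p
*-congʳ p q≈ = *-cong q≈ (≈-refl {p})

+-interchange : ∀ p q r s → (p + q) + (r + s) ≈ (p + r) + (q + s)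
+-interchange p q r s = begin
  (p + q) + (r + s)   ≈⟨ +-assoc p q (r + s) ⟩
  p + (q + (r + s))   ≈⟨ +-congˡ p (+-assoc q r s) ⟨
  p + ((q + r) + s)   ≈⟨ +-congˡ p (+-congʳ s (+-comm q r)) ⟩
  p + ((r + q) + s)   ≈⟨ +-congˡ p (+-assoc r q s) ⟩
  p + (r + (q + s))   ≈⟨ +-assoc p r (q + s) ⟨
  (p + r) + (q + s)   ∎
  where open ≈-Reasoning

·-distribˡ-+ : ∀ c p q → c · (p + q) ≈ c · p + c · q
·-distribˡ-+ c []      q       = ≈-refl
·-distribˡ-+ c (d ∷ p) []      = ≈-refl
·-distribˡ-+ c (d ∷ p) (e ∷ q) = ∷-cong (ℤ.*-distribˡ-+ c d e) (·-distribˡ-+ c p q)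

·-distribʳ-+ : ∀ c d p → (c ℤ.+ d) · p ≈ c · p + d · p
·-distribʳ-+ c d []      = ≈-refl
·-distribʳ-+ c d (e ∷ p) = ∷-cong (ℤ.*-distribʳ-+ e c d) (·-distribʳ-+ c d p)

·-assoc : ∀ c d p → (c ℤ.* d) · p ≈ c · (d · p)
·-assoc c d []      = ≈-refl
·-assoc c d (e ∷ p) = ∷-cong (ℤ.*-assoc c d e) (·-assoc c d p)

0·p≈[] : ∀ p → 0ℤ · p ≈ []
0·p≈[] p = mk≈ (coeff-· 0ℤ p)

1·p≈p : ∀ p → 1ℤ · p ≈ p
1·p≈p p = mk≈ λ n → trans (coeff-· 1ℤ p n) (ℤ.*-identityˡ _)

·-*-assoc : ∀ c p q → (c · p) * q ≈ c · (p * q)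
·-*-assoc c []      q = ≈-refl
·-*-assoc c (d ∷ p) q = begin
  (c ℤ.* d) · q + (0ℤ ∷ (c · p) * q)    ≈⟨ +-cong (·-assoc c d q) (∷-cong (sym (ℤ.*-zeroʳ c)) (·-*-assoc c p q)) ⟩
  c · d · q + c · (0ℤ ∷ p * q)          ≈⟨ ·-distribˡ-+ c (d · q) (0ℤ ∷ p * q) ⟨
  c · (d · q + (0ℤ ∷ p * q))            ∎
  where open ≈-Reasoning

0∷-* : ∀ p q → (0ℤ ∷ p) * q ≈ 0ℤ ∷ p * q
0∷-* p q = +-cong (0·p≈[] q) ≈-refl

*-zeroʳ : ∀ p → p * [] ≈ []
*-zeroʳ []      = ≈-refl
*-zeroʳ (c ∷ p) = ≈-trans (∷-cong refl (*-zeroʳ p)) 0∷[]≈[]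

-- The recursion of `_*_` mirrored in the second argument, which is what the induction for `*-comm`
-- needs.
*-∷ : ∀ p d q → p * (d ∷ q) ≈ d · p + (0ℤ ∷ p * q)
*-∷ []      d q = ≈-sym 0∷[]≈[]
*-∷ (c ∷ p) d q = ∷-cong (trans (ℤ.+-identityʳ _) (trans (ℤ.*-comm c d) (sym (ℤ.+-identityʳ _)))) (begin
  c · q + p * (d ∷ q)               ≈⟨ +-congˡ (c · q) (*-∷ p d q) ⟩
  c · q + (d · p + (0ℤ ∷ p * q))    ≈⟨ +-assoc (c · q) (d · p) _ ⟨
  (c · q + d · p) + (0ℤ ∷ p * q)    ≈⟨ +-congʳ (0ℤ ∷ p * q) (+-comm (c · q) (d · p)) ⟩
  (d · p + c · q) + (0ℤ ∷ p * q)    ≈⟨ +-assoc (d · p) (c · q) _ ⟩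
  d · p + (c · q + (0ℤ ∷ p * q))    ∎)
  where open ≈-Reasoning

*-comm : ∀ p q → p * q ≈ q * p
*-comm []      q = ≈-sym (*-zeroʳ q)
*-comm (c ∷ p) q = ≈-trans (+-cong ≈-refl (∷-cong refl (*-comm p q))) (≈-sym (*-∷ q c p))

*-distribʳ-+ : ∀ r p q → (p + q) * r ≈ p * r + q * r
*-distribʳ-+ r []      q       = ≈-refl
*-distribʳ-+ r (c ∷ p) []      = ≈-sym (+-identityʳ _)
*-distribʳ-+ r (c ∷ p) (d ∷ q) = begin
  (c ℤ.+ d) · r + (0ℤ ∷ (p + q) * r)                  ≈⟨ +-cong (·-distribʳ-+ c d r) (∷-cong refl (*-distribʳ-+ r p q)) ⟩
  (c · r + d · r) + ((0ℤ ∷ p * r) + (0ℤ ∷ q * r))     ≈⟨ +-interchange (c · r) (d · r) _ _ ⟩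
  (c ∷ p) * r + (d ∷ q) * r                           ∎
  where open ≈-Reasoning

*-distribˡ-+ : ∀ r p q → r * (p + q) ≈ r * p + r * q
*-distribˡ-+ r p q = begin
  r * (p + q)     ≈⟨ *-comm r (p + q) ⟩
  (p + q) * r     ≈⟨ *-distribʳ-+ r p q ⟩
  p * r + q * r   ≈⟨ +-cong (*-comm p r) (*-comm q r) ⟩
  r * p + r * q   ∎
  where open ≈-Reasoning

*-assoc : ∀ p q r → (p * q) * r ≈ p * (q * r)
*-assoc []      q r = ≈-refl
*-assoc (c ∷ p) q r = begin
  (c · q + (0ℤ ∷ p * q)) * r          ≈⟨ *-distribʳ-+ r (c · q) (0ℤ ∷ p * q) ⟩
  (c · q) * r + (0ℤ ∷ p * q) * r      ≈⟨ +-cong (·-*-assoc c q r) (0∷-* (p * q) r) ⟩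
  c · (q * r) + (0ℤ ∷ (p * q) * r)    ≈⟨ +-cong ≈-refl (∷-cong refl (*-assoc p q r)) ⟩
  c · (q * r) + (0ℤ ∷ p * (q * r))    ∎
  where open ≈-Reasoning

const-* : ∀ c p → const c * p ≈ c · p
const-* c p = ≈-trans (+-cong ≈-refl 0∷[]≈[]) (+-identityʳ _)

*-identityˡ : ∀ p → const 1ℤ * p ≈ p
*-identityˡ p = ≈-trans (const-* 1ℤ p) (1·p≈p p)

*-identityʳ : ∀ p → p * const 1ℤ ≈ p
*-identityʳ p = ≈-trans (*-comm p (const 1ℤ)) (*-identityˡ p)

ℤ[t]-isCommutativeRing : IsCommutativeRing _≈_ _+_ _*_ -_ [] (const 1ℤ)
ℤ[t]-isCommutativeRing = record
  { isRing = record
    { +-isAbelianGroup = record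
      { isGroup = record
        { isMonoid = record
          { isSemigroup = record
            { isMagma = record { isEquivalence = ≈-isEquivalence ; ∙-cong = +-cong }
            ; assoc   = +-assoc
            }
          ; identity = (λ _ → ≈-refl) , +-identityʳ
          }
        ; inverse = -‿inverseˡ , -‿inverseʳ
        ; ⁻¹-cong = -‿cong
        }
      ; comm = +-comm
      }
    ; *-cong     = *-cong
    ; *-assoc    = *-assoc
    ; *-identity = *-identityˡ , *-identityʳ
    ; distrib    = *-distribˡ-+ , *-distribʳ-+
    }
  ; *-comm = *-comm
  }

ℤ[t]-commutativeRing : CommutativeRing 0ℓ 0ℓ
ℤ[t]-commutativeRing = record { isCommutativeRing = ℤ[t]-isCommutativeRing }

All-0⇒≈[] : ∀ {p} → All (_≡ 0ℤ) p → p ≈ []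
All-0⇒≈[] []           = ≈-refl
All-0⇒≈[] (c≡0 ∷ p≡0) = ≈-trans (∷-cong c≡0 (All-0⇒≈[] p≡0)) 0∷[]≈[]

≈[]⇒All-0 : ∀ p → p ≈ [] → All (_≡ 0ℤ) p
≈[]⇒All-0 []      _   = []
≈[]⇒All-0 (c ∷ p) p≈0 = coeff-≡ p≈0 0 ∷ ≈[]⇒All-0 p (≈-tail-[] p≈0)

infix 4 _≈[]?
_≈[]? : ∀ p → Dec (p ≈ [])
p ≈[]? = map′ All-0⇒≈[] (≈[]⇒All-0 p) (all? (ℤ._≟ 0ℤ) p)

open import Tactic.RingSolver.NonReflective
  (fromCommutativeRing ℤ[t]-commutativeRing λ p → Maybe.map ≈-sym (dec⇒maybe (p ≈[]?)))
  using (solve; _⊕_; _⊗_; ⊝_; Κ) renaming (_⊜_ to infix 4 _⊜_)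

-- Prime ideals and degrees

module _
  {I : ℤ → Set} (0∈I : I 0ℤ) (+-closed : ∀ {a b} → I a → I b → I (a ℤ.+ b))
  (*-absorbs : ∀ a {b} → I b → I (a ℤ.* b))
  (prime : ∀ a b → I (a ℤ.* b) → I a ⊎ I b)
  where

  private
    +-cancelˡ : ∀ {a b} → I a → I (a ℤ.+ b) → I b
    +-cancelˡ {a} {b} a∈I a+b∈I = subst I (lemma a b) (+-closed (*-absorbs -1ℤ a∈I) a+b∈I)
      where
      lemma : ∀ a b → -1ℤ ℤ.* a ℤ.+ (a ℤ.+ b) ≡ b
      lemma = solve-∀

    extend : ∀ {c p} → I c → (∀ n → I (coeff p n)) → ∀ n → I (coeff (c ∷ p) n)
    extend c∈I p∈I zero    = c∈I
    extend c∈I p∈I (suc n) = p∈I n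

  -- The quotient of ℤ[t] by the polynomials with coefficients in a prime ideal is a domain. The
  -- product of the constant terms lies in `I`, so one of them does, and dropping it leaves a
  -- shorter pair whose product still has all coefficients in `I`. The zero ideal gives the absence
  -- of zero divisors, the ideal of a prime number gives the core of Gauss's lemma.
  primeIdeal-coeffs : ∀ p q → (∀ n → I (coeff (p * q) n)) →
                      (∀ n → I (coeff p n)) ⊎ (∀ n → I (coeff q n))
  primeIdeal-coeffs []      q       _    = inj₁ λ _ → 0∈I
  primeIdeal-coeffs (c ∷ p) []      _    = inj₂ λ _ → 0∈I
  primeIdeal-coeffs (c ∷ p) (d ∷ q) pq∈I =
    Sum.[ (λ c∈I → Sum.map₁ (extend c∈I) $ primeIdeal-coeffs p (d ∷ q) λ n →
             +-cancelˡ (subst I (ℤ.*-comm _ c) (*-absorbs (coeff q n) c∈I))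
                       (subst I (coeff-*-suc c p (d ∷ q) n) (pq∈I (suc n))))
        , (λ d∈I → Sum.map₂ (extend d∈I) $ primeIdeal-coeffs (c ∷ p) q λ n →
             +-cancelˡ (subst I (ℤ.*-comm _ d) (*-absorbs (coeff p n) d∈I))
                       (subst I (coeff-sucʳ n) (pq∈I (suc n))))
        ] (prime c d (subst I (coeff-*-zero c p (d ∷ q)) (pq∈I 0)))
    where
    coeff-sucʳ : ∀ n → coeff ((c ∷ p) * (d ∷ q)) (suc n) ≡ d ℤ.* coeff p n ℤ.+ coeff ((c ∷ p) * q) n
    coeff-sucʳ n = begin
      coeff ((c ∷ p) * (d ∷ q)) (suc n)                  ≡⟨ coeff-≡ (*-∷ (c ∷ p) d q) (suc n) ⟩
      coeff (d · p + (c ∷ p) * q) n                      ≡⟨ coeff-+ (d · p) ((c ∷ p) * q) n ⟩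
      coeff (d · p) n ℤ.+ coeff ((c ∷ p) * q) n          ≡⟨ cong (λ x → x ℤ.+ coeff ((c ∷ p) * q) n) (coeff-· d p n) ⟩
      d ℤ.* coeff p n ℤ.+ coeff ((c ∷ p) * q) n          ∎
      where open ≡-Reasoning

p*q≈[]⇒p≈[]∨q≈[] : ∀ p q → p * q ≈ [] → p ≈ [] ⊎ q ≈ []
p*q≈[]⇒p≈[]∨q≈[] p q pq≈0 = Sum.map mk≈ mk≈ $
  primeIdeal-coeffs {_≡ 0ℤ} refl (cong₂ ℤ._+_) (λ a b≡0 → trans (cong (a ℤ.*_) b≡0) (ℤ.*-zeroʳ a))
    (λ a b → ℤ.i*j≡0⇒i≡0∨j≡0 a) p q (coeff-≡ pq≈0)

coeffs∣⇒const∣ : ∀ c p → (∀ n → c ℤ∣.∣ coeff p n) → const c ∣ p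
coeffs∣⇒const∣ c []      _   = [] , ≈-refl
coeffs∣⇒const∣ c (d ∷ p) c∣p with c∣p 0 | coeffs∣⇒const∣ c p (c∣p ⊚ suc)
... | ℤ∣.divides e d≡e*c | q , qc≈p = (e ∷ q) , (begin
  (e ∷ q) * const c            ≈⟨ *-comm (e ∷ q) (const c) ⟩
  const c * (e ∷ q)            ≈⟨ const-* c (e ∷ q) ⟩
  (c ℤ.* e) ∷ c · q            ≈⟨ ∷-cong (ℤ.*-comm e c) (const-* c q) ⟨
  (e ℤ.* c) ∷ const c * q      ≈⟨ ∷-cong (sym d≡e*c) (≈-trans (*-comm (const c) q) qc≈p) ⟩
  d ∷ p                        ∎)
  where open ≈-Reasoning

coeff-const-* : ∀ c p n → coeff (const c * p) n ≡ c ℤ.* coeff p n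
coeff-const-* c p n = trans (coeff-≡ (const-* c p) n) (coeff-· c p n)

const∣⇒coeffs∣ : ∀ {c p} → const c ∣ p → ∀ n → c ℤ∣.∣ coeff p n
const∣⇒coeffs∣ {c} {p} (q , qc≈p) n = ℤ∣.divides (coeff q n) (begin
  coeff p n                ≡⟨ coeff-≡ qc≈p n ⟨
  coeff (q * const c) n    ≡⟨ coeff-≡ (*-comm q (const c)) n ⟩
  coeff (const c * q) n    ≡⟨ coeff-const-* c q n ⟩
  c ℤ.* coeff q n          ≡⟨ ℤ.*-comm c _ ⟩
  coeff q n ℤ.* c          ∎)
  where open ≡-Reasoning

primeConstant-∣* : ∀ {ℓ} → ℕ.Prime ℓ → ∀ p q → const (+ ℓ) ∣ p * q →
                   const (+ ℓ) ∣ p ⊎ const (+ ℓ) ∣ q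
primeConstant-∣* {ℓ} ℓ-prime p q ℓ∣pq = Sum.map (coeffs∣⇒const∣ _ p) (coeffs∣⇒const∣ _ q) $
  primeIdeal-coeffs {+ ℓ ℤ∣.∣_} (ℤ∣.divides 0ℤ refl) ℤ∣.∣m∣n⇒∣m+n ℤ∣.∣n⇒∣m*n prime p q (const∣⇒coeffs∣ ℓ∣pq)
  where
  prime : ∀ a b → + ℓ ℤ∣.∣ a ℤ.* b → (+ ℓ ℤ∣.∣ a) ⊎ (+ ℓ ℤ∣.∣ b)
  prime a b ℓ∣ab = Sum.map (λ d → ℤ∣.∣ᵤ⇒∣ d) (λ d → ℤ∣.∣ᵤ⇒∣ d) (ℕ.euclidsLemma ℤ.∣ a ∣ ℤ.∣ b ∣ ℓ-prime
    (subst (ℓ ℕ.∣_) (ℤ.abs-* a b) (ℤ∣.∣⇒∣ᵤ ℓ∣ab)))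

infix 4 _deg<_
-- A bound on coefficients is closed under sums and invariant under `≈`, and `p deg< 0` singles out
-- the zero polynomial, to which `deg` assigns the same value as to other constants.
_deg<_ : Poly → ℕ → Set
p deg< d = ∀ n → d ≤ n → coeff p n ≡ 0ℤ

deg<-resp-≈ : ∀ {p q d} → p ≈ q → p deg< d → q deg< d
deg<-resp-≈ p≈q p<d n d≤n = trans (sym (coeff-≡ p≈q n)) (p<d n d≤n)

deg<-mono : ∀ {p d e} → d ≤ e → p deg< d → p deg< e
deg<-mono d≤e p<d n e≤n = p<d n (ℕ.≤-trans d≤e e≤n)

deg<-tail : ∀ {c p d} → (c ∷ p) deg< suc d → p deg< d
deg<-tail p<d n d≤n = p<d (suc n) (s≤s d≤n)

deg<0⇒≈[] : ∀ {p} → p deg< 0 → p ≈ []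
deg<0⇒≈[] p<0 = mk≈ λ n → p<0 n z≤n

deg<1⇒≈const : ∀ {p} → p deg< 1 → p ≈ const (coeff p 0)
deg<1⇒≈const p<1 = mk≈ λ { zero → refl ; (suc n) → p<1 (suc n) z<s }

const-deg<1 : ∀ c → const c deg< 1
const-deg<1 c (suc n) _ = refl

deg<-+ : ∀ p q {d} → p deg< d → q deg< d → p + q deg< d
deg<-+ p q p<d q<d n d≤n = trans (coeff-+ p q n) (cong₂ ℤ._+_ (p<d n d≤n) (q<d n d≤n))

deg<-‿- : ∀ p {d} → p deg< d → - p deg< d
deg<-‿- p p<d n d≤n = trans (coeff-‿- p n) (cong ℤ.-_ (p<d n d≤n))

deg<-deg : ∀ p → p deg< suc (deg p)
deg<-deg []      _       _         = refl
deg<-deg (c ∷ p) (suc n) (s≤s d≤n) with all? (ℤ._≟ 0ℤ) p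
... | yes p≡0 = coeff-≡ (All-0⇒≈[] p≡0) n
... | no  _   = deg<-deg p n d≤n

coeff-deg≢0 : ∀ p → ¬ p ≈ [] → coeff p (deg p) ≢ 0ℤ
coeff-deg≢0 []      p≉0 _ = p≉0 ≈-refl
coeff-deg≢0 (c ∷ p) p≉0 eq with all? (ℤ._≟ 0ℤ) p
... | yes p≡0 = p≉0 (≈-trans (∷-cong eq (All-0⇒≈[] p≡0)) 0∷[]≈[])
... | no  p≢0 = coeff-deg≢0 p (p≢0 ⊚ ≈[]⇒All-0 p) eq

deg-≤ : ∀ p {d} → p deg< suc d → deg p ≤ d
deg-≤ []      _ = z≤n
deg-≤ (c ∷ p) p<d with all? (ℤ._≟ 0ℤ) p
deg-≤ (c ∷ p) {d}     p<d | yes _   = z≤n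
deg-≤ (c ∷ p) {zero}  p<d | no  p≢0 = contradiction (≈[]⇒All-0 p (deg<0⇒≈[] (deg<-tail p<d))) p≢0
deg-≤ (c ∷ p) {suc d} p<d | no  _   = s≤s (deg-≤ p (deg<-tail p<d))

coeff≢0⇒≤deg : ∀ p {n} → coeff p n ≢ 0ℤ → n ≤ deg p
coeff≢0⇒≤deg p {n} pₙ≢0 = ℕ.≮⇒≥ λ deg<n → pₙ≢0 (deg<-deg p n deg<n)

deg-unique : ∀ p {n} → coeff p n ≢ 0ℤ → p deg< suc n → deg p ≡ n
deg-unique p pₙ≢0 p<n = ℕ.≤-antisym (deg-≤ p p<n) (coeff≢0⇒≤deg p pₙ≢0)

deg-cong : ∀ {p q} → p ≈ q → deg p ≡ deg q
deg-cong {p} {q} p≈q = ℕ.≤-antisym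
  (deg-≤ p (deg<-resp-≈ (≈-sym p≈q) (deg<-deg q))) (deg-≤ q (deg<-resp-≈ p≈q (deg<-deg p)))

deg<-* : ∀ p q {m n} → p deg< suc m → q deg< suc n → p * q deg< suc (m ℕ.+ n)
coeff-*-top : ∀ p q {m n} → p deg< suc m → q deg< suc n →
              coeff (p * q) (m ℕ.+ n) ≡ coeff p m ℤ.* coeff q n

private
  -- A list bounded by degree 0 can still have a tail of zeros, so the base cases below go through
  -- `≈`.
  constˡ-* : ∀ {c p} q → (c ∷ p) deg< 1 → (c ∷ p) * q ≈ c · q
  constˡ-* {c} q p<1 = ≈-trans (*-congʳ q (deg<1⇒≈const p<1)) (const-* c q)

deg<-* []      q _ _ _ _ = refl
deg<-* (c ∷ p) q {zero} p<1 q<n k n<k =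
  trans (coeff-≡ (constˡ-* q p<1) k) (trans (coeff-· c q k) (trans (cong (c ℤ.*_) (q<n k n<k)) (ℤ.*-zeroʳ c)))
deg<-* (c ∷ p) q {suc m} {n} p<m q<n (suc k) (s≤s m+n<k) = begin
  coeff ((c ∷ p) * q) (suc k)                     ≡⟨ coeff-*-suc c p q k ⟩
  c ℤ.* coeff q (suc k) ℤ.+ coeff (p * q) k       ≡⟨ cong₂ (λ x y → c ℤ.* x ℤ.+ y)
                                                       (q<n (suc k) (ℕ.≤-trans (s≤s (ℕ.m≤n+m n m)) (ℕ.m≤n⇒m≤1+n m+n<k)))
                                                       (deg<-* p q (deg<-tail p<m) q<n k m+n<k) ⟩
  c ℤ.* 0ℤ ℤ.+ 0ℤ                                 ≡⟨ cong (ℤ._+ 0ℤ) (ℤ.*-zeroʳ c) ⟩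
  0ℤ                                              ∎
  where open ≡-Reasoning

coeff-*-top []      q _ _ = refl
coeff-*-top (c ∷ p) q {zero} {n} p<1 q<n = trans (coeff-≡ (constˡ-* q p<1) n) (coeff-· c q n)
coeff-*-top (c ∷ p) q {suc m} {n} p<m q<n = begin
  coeff ((c ∷ p) * q) (suc (m ℕ.+ n))                          ≡⟨ coeff-*-suc c p q (m ℕ.+ n) ⟩
  c ℤ.* coeff q (suc (m ℕ.+ n)) ℤ.+ coeff (p * q) (m ℕ.+ n)    ≡⟨ cong₂ (λ x y → c ℤ.* x ℤ.+ y)
                                                                    (q<n (suc (m ℕ.+ n)) (s≤s (ℕ.m≤n+m n m)))
                                                                    (coeff-*-top p q (deg<-tail p<m) q<n) ⟩
  c ℤ.* 0ℤ ℤ.+ coeff p m ℤ.* coeff q n                         ≡⟨ cong (λ x → x ℤ.+ coeff p m ℤ.* coeff q n) (ℤ.*-zeroʳ c) ⟩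
  0ℤ ℤ.+ coeff p m ℤ.* coeff q n                               ≡⟨ ℤ.+-identityˡ _ ⟩
  coeff p m ℤ.* coeff q n                                      ∎
  where open ≡-Reasoning

deg-* : ∀ p q → ¬ p ≈ [] → ¬ q ≈ [] → deg (p * q) ≡ deg p ℕ.+ deg q
deg-* p q p≉0 q≉0 = deg-unique (p * q)
  (λ eq → Sum.[ coeff-deg≢0 p p≉0 , coeff-deg≢0 q q≉0 ]
    (ℤ.i*j≡0⇒i≡0∨j≡0 (coeff p (deg p)) (trans (sym (coeff-*-top p q (deg<-deg p) (deg<-deg q))) eq)))
  (deg<-* p q (deg<-deg p) (deg<-deg q))

open ≈-Reasoning

p-q≈[]⇒p≈q : ∀ p q → p - q ≈ [] → p ≈ q
p-q≈[]⇒p≈q p q p-q≈0 = begin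
  p              ≈⟨ solve 2 (λ p q → p ⊜ (p ⊕ ⊝ q) ⊕ q) ≈-refl p q ⟩
  (p - q) + q    ≈⟨ +-congʳ q p-q≈0 ⟩
  q              ∎

*-cancelˡ : ∀ f p q → ¬ f ≈ [] → f * p ≈ f * q → p ≈ q
*-cancelˡ f p q f≉0 fp≈fq = p-q≈[]⇒p≈q p q (Sum.[ (λ f≈0 → contradiction f≈0 f≉0) , (λ eq → eq) ]
  (p*q≈[]⇒p≈[]∨q≈[] f (p - q) (begin
    f * (p - q)        ≈⟨ solve 3 (λ f p q → f ⊗ (p ⊕ ⊝ q) ⊜ f ⊗ p ⊕ ⊝ (f ⊗ q)) ≈-refl f p q ⟩
    f * p - f * q      ≈⟨ +-congʳ (- (f * q)) fp≈fq ⟩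
    f * q - f * q      ≈⟨ -‿inverseʳ (f * q) ⟩
    []                 ∎)))

const-cong : ∀ {c d} → c ≡ d → const c ≈ const d
const-cong refl = ≈-refl

const-*-homo : ∀ c d → const (c ℤ.* d) ≈ const c * const d
const-*-homo c d = ≈-sym (const-* c (const d))

const≉[] : ∀ {c} → c ≢ 0ℤ → ¬ const c ≈ []
const≉[] c≢0 c≈0 = c≢0 (coeff-≡ c≈0 0)

deg-const-* : ∀ {c} p → c ≢ 0ℤ → deg (const c * p) ≡ deg p
deg-const-* {c} p c≢0 = ℕ.≤-antisym
  (deg-≤ (const c * p) λ n d<n → trans (coeff-const-* c p n)
    (trans (cong (c ℤ.*_) (deg<-deg p n d<n)) (ℤ.*-zeroʳ c)))
  (deg-≤ p λ n d<n → Sum.[ (λ c≡0 → contradiction c≡0 c≢0) , (λ eq → eq) ]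
    (ℤ.i*j≡0⇒i≡0∨j≡0 c (trans (sym (coeff-const-* c p n)) (deg<-deg (const c * p) n d<n))))

deg<⇒deg-< : ∀ p {d} → p deg< d → ¬ p ≈ [] → deg p < d
deg<⇒deg-< p p<d p≉0 = ℕ.≰⇒> λ d≤deg → coeff-deg≢0 p p≉0 (p<d (deg p) d≤deg)

deg≡0⇒≈const : ∀ p → deg p ≡ 0 → p ≈ const (coeff p 0)
deg≡0⇒≈const p deg≡0 = deg<1⇒≈const (subst (p deg<_) (cong suc deg≡0) (deg<-deg p))

-- Pseudo-division

-- Cross-multiplication by the coefficients at `d` cancels these two terms. As `d` is a mere bound,
-- either coefficient may be zero.
cancel-top : ∀ p q {d} → p deg< suc d → q deg< suc d →
             const (coeff q d) * p - const (coeff p d) * q deg< d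
cancel-top p q {d} p<d q<d n d≤n = ≡.trans coeff-difference (case-n (ℕ.m≤n⇒m<n∨m≡n d≤n))
  where
  a = coeff p d
  b = coeff q d

  coeff-difference : coeff (const b * p - const a * q) n ≡ b ℤ.* coeff p n ℤ.- a ℤ.* coeff q n
  coeff-difference = trans (coeff-+ (const b * p) (- (const a * q)) n)
    (cong₂ ℤ._+_ (coeff-const-* b p n)
      (trans (coeff-‿- (const a * q) n) (cong ℤ.-_ (coeff-const-* a q n))))

  case-n : d < n ⊎ d ≡ n → b ℤ.* coeff p n ℤ.- a ℤ.* coeff q n ≡ 0ℤ
  case-n (inj₁ d<n) = trans
    (cong₂ (λ x y → b ℤ.* x ℤ.- a ℤ.* y) (p<d n d<n) (q<d n d<n))
    (cong₂ ℤ._-_ (ℤ.*-zeroʳ b) (ℤ.*-zeroʳ a))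
  case-n (inj₂ refl) = trans (cong (λ x → x ℤ.- a ℤ.* b) (ℤ.*-comm b a)) (ℤ.+-inverseʳ (a ℤ.* b))

-- Induction on the coefficients of the dividend: passing from `p` to `a + t p` shifts the remainder
-- `r` to `r′`, which exceeds the bound by at most one degree, and one more elimination with the
-- leading coefficient `l` of `d` repairs this. The multiplier `c` is thus a power of `l`. For a
-- constant `d` the bound on `r` says that `r` vanishes.
pseudoDivide : ∀ d → ¬ d ≈ [] → ∀ p → ∃ λ c → ∃₂ λ q r →
               c ≢ 0ℤ × const c * p ≈ d * q + r × r deg< deg d
pseudoDivide d d≉0 [] = 1ℤ , [] , [] , (λ ()) ,
  ≈-trans 0∷[]≈[] (≈-sym (≈-trans (+-identityʳ _) (*-zeroʳ d))) , λ _ _ → refl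
pseudoDivide d d≉0 (a ∷ p) with pseudoDivide d d≉0 p
... | c , q , r , c≢0 , cp≈dq+r , r<d =
  l ℤ.* c , const l * (0ℤ ∷ q) + const s , const l * r′ - const s * d ,
  (λ lc≡0 → Sum.[ coeff-deg≢0 d d≉0 , c≢0 ] (ℤ.i*j≡0⇒i≡0∨j≡0 l lc≡0)) ,
  division , cancel-top r′ d r′<d (deg<-deg d)
  where
  l = coeff d (deg d)
  r′ = (c ℤ.* a) ∷ r
  s = coeff r′ (deg d)

  r′<d : r′ deg< suc (deg d)
  r′<d (suc n) (s≤s d≤n) = r<d n d≤n

  shifted : const c * (a ∷ p) ≈ d * (0ℤ ∷ q) + r′
  shifted = begin
    const c * (a ∷ p)                  ≈⟨ const-* c (a ∷ p) ⟩
    (c ℤ.* a) ∷ c · p                  ≈⟨ ∷-cong (sym (ℤ.+-identityˡ _)) (≈-trans (≈-sym (const-* c p)) cp≈dq+r) ⟩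
    (0ℤ ∷ d * q) + r′                  ≈⟨ +-congʳ r′ (∷-cong {0ℤ} refl (*-comm d q)) ⟩
    (0ℤ ∷ q * d) + r′                  ≈⟨ +-congʳ r′ (0∷-* q d) ⟨
    (0ℤ ∷ q) * d + r′                  ≈⟨ +-congʳ r′ (*-comm (0ℤ ∷ q) d) ⟩
    d * (0ℤ ∷ q) + r′                  ∎

  division : const (l ℤ.* c) * (a ∷ p) ≈
             d * (const l * (0ℤ ∷ q) + const s) + (const l * r′ - const s * d)
  division = begin
    const (l ℤ.* c) * (a ∷ p)              ≈⟨ *-congʳ (a ∷ p) (const-*-homo l c) ⟩
    const l * const c * (a ∷ p)            ≈⟨ *-assoc (const l) (const c) (a ∷ p) ⟩
    const l * (const c * (a ∷ p))          ≈⟨ *-congˡ (const l) shifted ⟩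
    const l * (d * (0ℤ ∷ q) + r′)          ≈⟨ solve 5 (λ l d q r s → l ⊗ (d ⊗ q ⊕ r) ⊜ d ⊗ (l ⊗ q ⊕ s) ⊕ (l ⊗ r ⊕ ⊝ (s ⊗ d)))
                                                ≈-refl (const l) d (0ℤ ∷ q) r′ (const s) ⟩
    d * (const l * (0ℤ ∷ q) + const s) + (const l * r′ - const s * d) ∎

-- A greatest common divisor over ℚ, with all denominators cleared.
record RationalGCD (p q : Poly) : Set where
  field
    d           : Poly
    d≉[]        : ¬ d ≈ []
    u v         : Poly
    combination : d ≈ u * p + v * q
    a b         : ℤ
    a≢0         : a ≢ 0ℤ
    b≢0         : b ≢ 0ℤ
    p/d q/d     : Poly
    d∣ap        : const a * p ≈ d * p/d
    d∣bq        : const b * q ≈ d * q/d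

-- Instead of alternating remainders, a nonzero element `d` of the ideal generated by `p` and `q` is
-- improved: if it fails to pseudo-divide one of the two, the nonzero remainder is again in the
-- ideal and has smaller degree. The number `n` is fuel bounding `deg d`.
euclid : ∀ p q n d u v → deg d < n → ¬ d ≈ [] → d ≈ u * p + v * q → RationalGCD p q
euclid p q (suc n) d u v (s≤s deg≤n) d≉0 d≈ with pseudoDivide d d≉0 p | pseudoDivide d d≉0 q
... | a , x , r , a≢0 , ap≈ , r<d | b , y , s , b≢0 , bq≈ , s<d with r ≈[]? | s ≈[]?
... | yes r≈0 | yes s≈0 = record
  { d = d ; d≉[] = d≉0 ; u = u ; v = v ; combination = d≈ ; a≢0 = a≢0 ; b≢0 = b≢0
  ; d∣ap = ≈-trans ap≈ (≈-trans (+-congˡ (d * x) r≈0) (+-identityʳ _))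
  ; d∣bq = ≈-trans bq≈ (≈-trans (+-congˡ (d * y) s≈0) (+-identityʳ _))
  }
... | no r≉0 | _ = euclid p q n r (const a - u * x) (- (v * x)) (ℕ.<-≤-trans (deg<⇒deg-< r r<d r≉0) deg≤n) r≉0 (begin
  r                                            ≈⟨ solve 2 (λ r z → r ⊜ (z ⊕ r) ⊕ ⊝ z) ≈-refl r (d * x) ⟩
  (d * x + r) - d * x                          ≈⟨ +-cong (≈-sym ap≈) (-‿cong (*-congʳ x d≈)) ⟩
  const a * p - (u * p + v * q) * x            ≈⟨ solve 6 (λ a p q u v x → a ⊗ p ⊕ ⊝ ((u ⊗ p ⊕ v ⊗ q) ⊗ x) ⊜
                                                    (a ⊕ ⊝ (u ⊗ x)) ⊗ p ⊕ ⊝ (v ⊗ x) ⊗ q) ≈-refl (const a) p q u v x ⟩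
  (const a - u * x) * p + - (v * x) * q        ∎)
... | yes _ | no s≉0 = euclid p q n s (- (u * y)) (const b - v * y) (ℕ.<-≤-trans (deg<⇒deg-< s s<d s≉0) deg≤n) s≉0 (begin
  s                                            ≈⟨ solve 2 (λ r z → r ⊜ (z ⊕ r) ⊕ ⊝ z) ≈-refl s (d * y) ⟩
  (d * y + s) - d * y                          ≈⟨ +-cong (≈-sym bq≈) (-‿cong (*-congʳ y d≈)) ⟩
  const b * q - (u * p + v * q) * y            ≈⟨ solve 6 (λ b p q u v y → b ⊗ q ⊕ ⊝ ((u ⊗ p ⊕ v ⊗ q) ⊗ y) ⊜
                                                    ⊝ (u ⊗ y) ⊗ p ⊕ (b ⊕ ⊝ (v ⊗ y)) ⊗ q) ≈-refl (const b) p q u v y ⟩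
  - (u * y) * p + (const b - v * y) * q        ∎)

rationalGCD : ∀ p q → ¬ p ≈ [] → RationalGCD p q
rationalGCD p q p≉0 = euclid p q (suc (deg p)) p (const 1ℤ) [] ℕ.≤-refl p≉0
  (≈-sym (≈-trans (+-identityʳ _) (*-identityˡ p)))

-- Gauss's lemma

-- Serves two purposes: removing an integer multiplier prime by prime, and building up the exponent
-- `n` of `tⁿ - 1`.
prime-induction : ∀ {a} (P : ℕ → Set a) → P 1 → (∀ {ℓ n} → ℕ.Prime ℓ → P n → P (ℓ ℕ.* n)) →
                  ∀ n .{{_ : NonZero n}} → P n
prime-induction P P1 step n with ℕ.factorise n
... | record { factors = ℓs ; isFactorisation = refl ; factorsPrime = n-primes } = go n-primes
  where
  go : ∀ {ℓs} → All ℕ.Prime ℓs → P (ℕ.product ℓs)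
  go {[]}     []                    = P1
  go {ℓ ∷ ℓs} (ℓ-prime ∷ ℓs-prime) = step ℓ-prime (go ℓs-prime)

const-prime≉[] : ∀ {ℓ} → ℕ.Prime ℓ → ¬ const (+ ℓ) ≈ []
const-prime≉[] ℓ-prime = const≉[] λ { refl → ℕ.¬prime[0] ℓ-prime }

const-abs : ∀ c → c ≢ 0ℤ → ∃ λ e → e ≢ 0ℤ × const (+ ℤ.∣ c ∣) ≈ const e * const c
const-abs c@(+ n)    c≢0 = 1ℤ , (λ ()) , ≈-sym (*-identityˡ (const c))
const-abs c@(-[1+ n ]) c≢0 = -1ℤ , (λ ()) , ≈-sym (≈-trans (≈-sym (const-*-homo -1ℤ c)) (const-cong (ℤ.-1*i≡-i c)))

deg-cofactor : ∀ {ℓ p} q → ℕ.Prime ℓ → q * const (+ ℓ) ≈ p → deg q ≡ deg p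
deg-cofactor {ℓ} {p} q ℓ-prime qℓ≈p = trans (sym (deg-const-* {+ ℓ} q λ { refl → ℕ.¬prime[0] ℓ-prime }))
  (deg-cong (≈-trans (*-comm (const (+ ℓ)) q) qℓ≈p))

const-*-cancel : ∀ {ℓ} → ℕ.Prime ℓ → ∀ n p q → const (+ (ℓ ℕ.* n)) * p ≈ const (+ ℓ) * q → const (+ n) * p ≈ q
const-*-cancel {ℓ} ℓ-prime n p q eq = *-cancelˡ (const (+ ℓ)) _ q (const-prime≉[] ℓ-prime) (begin
  const (+ ℓ) * (const (+ n) * p)    ≈⟨ *-assoc (const (+ ℓ)) (const (+ n)) p ⟨
  const (+ ℓ) * const (+ n) * p      ≈⟨ *-congʳ p (const-*-homo (+ ℓ) (+ n)) ⟨
  const (+ ℓ ℤ.* + n) * p            ≈⟨ *-congʳ p (const-cong (ℤ.pos-* ℓ n)) ⟨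
  const (+ (ℓ ℕ.* n)) * p            ≈⟨ eq ⟩
  const (+ ℓ) * q                    ∎)

-- The new factors will be `d` and `q` up to rational constants. Their degrees are recorded because
-- these tell whether `d` or `q` is constant.
SameDegreeFactors : Poly → Poly → Poly → Set
SameDegreeFactors p d q = ∃₂ λ d′ q′ → p ≈ d′ * q′ × deg d′ ≡ deg d × deg q′ ≡ deg q

-- A prime `ℓ` of the multiplier divides `d * q`, hence `d` or `q`; dividing it out there leaves the
-- degree unchanged.
gauss-ℕ : ∀ p n .{{_ : NonZero n}} d q → const (+ n) * p ≈ d * q → SameDegreeFactors p d q
gauss-ℕ p = prime-induction (λ n → ∀ d q → const (+ n) * p ≈ d * q → SameDegreeFactors p d q)
  (λ d q eq → d , q , ≈-trans (≈-sym (*-identityˡ p)) eq , refl , refl)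
  step
  where
  step : ∀ {ℓ n} → ℕ.Prime ℓ → (∀ d q → const (+ n) * p ≈ d * q → SameDegreeFactors p d q) →
         ∀ d q → const (+ (ℓ ℕ.* n)) * p ≈ d * q → SameDegreeFactors p d q
  step {ℓ} {n} ℓ-prime ih d q eq with primeConstant-∣* ℓ-prime d q (const (+ n) * p , (begin
    const (+ n) * p * const (+ ℓ)      ≈⟨ solve 3 (λ n p ℓ → n ⊗ p ⊗ ℓ ⊜ ℓ ⊗ n ⊗ p) ≈-refl (const (+ n)) p (const (+ ℓ)) ⟩
    const (+ ℓ) * const (+ n) * p      ≈⟨ *-congʳ p (const-*-homo (+ ℓ) (+ n)) ⟨
    const (+ ℓ ℤ.* + n) * p            ≈⟨ *-congʳ p (const-cong (ℤ.pos-* ℓ n)) ⟨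
    const (+ (ℓ ℕ.* n)) * p            ≈⟨ eq ⟩
    d * q                              ∎))
  ... | inj₁ (d₁ , d₁ℓ≈d) with ih d₁ q (const-*-cancel ℓ-prime n p (d₁ * q) (begin
    const (+ (ℓ ℕ.* n)) * p            ≈⟨ eq ⟩
    d * q                              ≈⟨ *-congʳ q d₁ℓ≈d ⟨
    d₁ * const (+ ℓ) * q               ≈⟨ solve 3 (λ d ℓ q → d ⊗ ℓ ⊗ q ⊜ ℓ ⊗ (d ⊗ q)) ≈-refl d₁ (const (+ ℓ)) q ⟩
    const (+ ℓ) * (d₁ * q)             ∎))
  ...   | d′ , q′ , p≈ , deg-d′ , deg-q′ = d′ , q′ , p≈ , trans deg-d′ (deg-cofactor d₁ ℓ-prime d₁ℓ≈d) , deg-q′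
  step {ℓ} {n} ℓ-prime ih d q eq | inj₂ (q₁ , q₁ℓ≈q) with ih d q₁ (const-*-cancel ℓ-prime n p (d * q₁) (begin
    const (+ (ℓ ℕ.* n)) * p            ≈⟨ eq ⟩
    d * q                              ≈⟨ *-congˡ d q₁ℓ≈q ⟨
    d * (q₁ * const (+ ℓ))             ≈⟨ solve 3 (λ d ℓ q → d ⊗ (q ⊗ ℓ) ⊜ ℓ ⊗ (d ⊗ q)) ≈-refl d (const (+ ℓ)) q₁ ⟩
    const (+ ℓ) * (d * q₁)             ∎))
  ...   | d′ , q′ , p≈ , deg-d′ , deg-q′ = d′ , q′ , p≈ , deg-d′ , trans deg-q′ (deg-cofactor q₁ ℓ-prime q₁ℓ≈q)


const-abs-* : ∀ c p q → c ≢ 0ℤ → ∃ λ e → e ≢ 0ℤ × (const c * p ≈ q → const (+ ℤ.∣ c ∣) * p ≈ const e * q)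
const-abs-* c p q c≢0 with const-abs c c≢0
... | e , e≢0 , ∣c∣≈ec = e , e≢0 , λ cp≈q → begin
  const (+ ℤ.∣ c ∣) * p          ≈⟨ *-congʳ p ∣c∣≈ec ⟩
  const e * const c * p          ≈⟨ *-assoc (const e) (const c) p ⟩
  const e * (const c * p)        ≈⟨ *-congˡ (const e) cp≈q ⟩
  const e * q                    ∎

∣c∣-nonZero : ∀ {c} → c ≢ 0ℤ → NonZero ℤ.∣ c ∣
∣c∣-nonZero c≢0 = ℕ.≢-nonZero (c≢0 ⊚ ℤ.∣i∣≡0⇒i≡0)

gauss : ∀ {c} p d q → c ≢ 0ℤ → const c * p ≈ d * q → SameDegreeFactors p d q
gauss {c} p d q c≢0 cp≈dq with const-abs-* c p (d * q) c≢0
... | e , e≢0 , abs with gauss-ℕ p ℤ.∣ c ∣ {{∣c∣-nonZero c≢0}} (const e * d) q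
                          (≈-trans (abs cp≈dq) (≈-sym (*-assoc (const e) d q)))
...   | d′ , q′ , p≈ , deg-d′ , deg-q′ = d′ , q′ , p≈ , trans deg-d′ (deg-const-* d e≢0) , deg-q′

-- Primitive polynomials and primality of irreducibles

-- Content one, phrased through primes because multipliers are removed one prime at a time.
Primitive : Poly → Set
Primitive p = ∀ {ℓ} → ℕ.Prime ℓ → ¬ const (+ ℓ) ∣ p

∣-resp-≈ : ∀ {p q r} → q ≈ r → p ∣ q → p ∣ r
∣-resp-≈ q≈r (s , sp≈q) = s , ≈-trans sp≈q q≈r

-- If `q * g` is `ℓ` times a polynomial, then `ℓ` divides `q` or `g`. Primitivity excludes `g`, so
-- `ℓ` can be cancelled from the cofactor `q`.
primitive-∣-ℕ : ∀ g p n .{{_ : NonZero n}} → Primitive g → g ∣ const (+ n) * p → g ∣ p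
primitive-∣-ℕ g p n g-primitive = prime-induction (λ n → g ∣ const (+ n) * p → g ∣ p)
  (∣-resp-≈ (*-identityˡ p)) step n
  where
  step : ∀ {ℓ n} → ℕ.Prime ℓ → (g ∣ const (+ n) * p → g ∣ p) → g ∣ const (+ (ℓ ℕ.* n)) * p → g ∣ p
  step {ℓ} {n} ℓ-prime ih (q , qg≈ℓnp) with primeConstant-∣* ℓ-prime q g (const (+ n) * p , (begin
    const (+ n) * p * const (+ ℓ)      ≈⟨ solve 3 (λ n p ℓ → n ⊗ p ⊗ ℓ ⊜ ℓ ⊗ n ⊗ p) ≈-refl (const (+ n)) p (const (+ ℓ)) ⟩
    const (+ ℓ) * const (+ n) * p      ≈⟨ *-congʳ p (const-*-homo (+ ℓ) (+ n)) ⟨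
    const (+ ℓ ℤ.* + n) * p            ≈⟨ *-congʳ p (const-cong (ℤ.pos-* ℓ n)) ⟨
    const (+ (ℓ ℕ.* n)) * p            ≈⟨ qg≈ℓnp ⟨
    q * g                              ∎))
  ... | inj₂ ℓ∣g = contradiction ℓ∣g (g-primitive ℓ-prime)
  ... | inj₁ (r , rℓ≈q) = ih (r , ≈-sym (const-*-cancel ℓ-prime n p (r * g) (begin
    const (+ (ℓ ℕ.* n)) * p            ≈⟨ qg≈ℓnp ⟨
    q * g                              ≈⟨ *-congʳ g rℓ≈q ⟨
    r * const (+ ℓ) * g                ≈⟨ solve 3 (λ d ℓ q → d ⊗ ℓ ⊗ q ⊜ ℓ ⊗ (d ⊗ q)) ≈-refl r (const (+ ℓ)) g ⟩
    const (+ ℓ) * (r * g)              ∎)))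

primitive-∣ : ∀ {c} g p → Primitive g → c ≢ 0ℤ → g ∣ const c * p → g ∣ p
primitive-∣ {c} g p g-primitive c≢0 (q , qg≈cp) with const-abs-* c p (q * g) c≢0
... | e , _ , abs = primitive-∣-ℕ g p ℤ.∣ c ∣ {{∣c∣-nonZero c≢0}} g-primitive
  (const e * q , ≈-trans (*-assoc (const e) q g) (≈-sym (abs (≈-sym qg≈cp))))

∣1⇒deg≡0 : ∀ p → p ∣ const 1ℤ → deg p ≡ 0
∣1⇒deg≡0 p (q , qp≈1) = ℕ.m+n≡0⇒n≡0 (deg q) (trans (sym (deg-* q p q≉0 p≉0)) (deg-cong qp≈1))
  where
  1≉0 : ¬ const 1ℤ ≈ []
  1≉0 = const≉[] λ ()
  q≉0 : ¬ q ≈ []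
  q≉0 q≈0 = 1≉0 (≈-trans (≈-sym qp≈1) (*-congʳ p q≈0))
  p≉0 : ¬ p ≈ []
  p≉0 p≈0 = 1≉0 (≈-trans (≈-sym qp≈1) (≈-trans (*-congˡ q p≈0) (*-zeroʳ q)))

const-prime∤1 : ∀ {ℓ} → ℕ.Prime ℓ → ¬ const (+ ℓ) ∣ const 1ℤ
const-prime∤1 ℓ-prime ℓ∣1 with ℕ.∣1⇒≡1 (ℤ∣.∣⇒∣ᵤ (const∣⇒coeffs∣ ℓ∣1 0))
... | refl = ℕ.¬prime[1] ℓ-prime

-- In `q ℓ ≈ p` the constant `ℓ` is no unit, so `q` is one and `p` has degree 0. Positive degree
-- thus rules out the prime constants.
irreducible⇒primitive : ∀ {p} → Irreducible p → 0 < deg p → Primitive p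
irreducible⇒primitive {p} p-irred 0<deg {ℓ} ℓ-prime (q , qℓ≈p)
  with Irreducible.split-∣1 p-irred {q} {const (+ ℓ)} (≈-sym qℓ≈p)
... | inj₂ ℓ∣1 = const-prime∤1 ℓ-prime ℓ∣1
... | inj₁ q∣1 = ℕ.<⇒≢ 0<deg (trans (sym (∣1⇒deg≡0 q q∣1)) (deg-cofactor q ℓ-prime qℓ≈p))

p*q≉[] : ∀ {p q} → ¬ p ≈ [] → ¬ q ≈ [] → ¬ p * q ≈ []
p*q≉[] {p} {q} p≉0 q≉0 pq≈0 = Sum.[ p≉0 , q≉0 ] (p*q≈[]⇒p≈[]∨q≈[] p q pq≈0)

*≉[]⇒≉[]ʳ : ∀ p {q} → ¬ p * q ≈ [] → ¬ q ≈ []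
*≉[]⇒≉[]ʳ p pq≉0 q≈0 = pq≉0 (≈-trans (*-congˡ p q≈0) (*-zeroʳ p))

*≉[]⇒≉[]ˡ : ∀ {p} q → ¬ p * q ≈ [] → ¬ p ≈ []
*≉[]⇒≉[]ˡ q pq≉0 p≈0 = pq≉0 (*-congʳ q p≈0)

-- With `d` the rational gcd of `p` and `x`, Gauss's lemma turns `a p ≈ d (p/d)` into a
-- factorisation of `p` itself with the same degrees. Irreducibility then makes `d` or `p/d`
-- constant.
irreducible⇒prime : ∀ {p} → Irreducible p → 0 < deg p → ∀ x y → p ∣ x * y → p ∣ x ⊎ p ∣ y
irreducible⇒prime {p} p-irred 0<deg x y (z , zp≈xy) = cases (gauss p d p/d a≢0 d∣ap)
  where
  p≉0 : ¬ p ≈ []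
  p≉0 p≈0 = ℕ.<⇒≢ 0<deg (sym (deg-cong p≈0))

  open RationalGCD (rationalGCD p x p≉0) renaming (q/d to x/d; d∣bq to d∣bx)

  p-primitive : Primitive p
  p-primitive = irreducible⇒primitive p-irred 0<deg

  cases : SameDegreeFactors p d p/d → p ∣ x ⊎ p ∣ y
  cases (d′ , q′ , p≈d′q′ , deg-d′ , deg-q′) with Irreducible.split-∣1 p-irred {d′} {q′} p≈d′q′
  -- Here `d` is a nonzero constant; `d ≈ u p + v x` times `y` shows that `p` divides this constant
  -- times `y`, and the constant is removed by primitivity.
  ... | inj₁ d′∣1 = inj₂ (primitive-∣ p y p-primitive c≢0 (u * y + v * z , (begin
    (u * y + v * z) * p              ≈⟨ solve 5 (λ u y v z p → (u ⊗ y ⊕ v ⊗ z) ⊗ p ⊜ u ⊗ p ⊗ y ⊕ v ⊗ (z ⊗ p)) ≈-refl u y v z p ⟩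
    u * p * y + v * (z * p)          ≈⟨ +-congˡ (u * p * y) (*-congˡ v zp≈xy) ⟩
    u * p * y + v * (x * y)          ≈⟨ solve 5 (λ u p v x y → u ⊗ p ⊗ y ⊕ v ⊗ (x ⊗ y) ⊜ (u ⊗ p ⊕ v ⊗ x) ⊗ y) ≈-refl u p v x y ⟩
    (u * p + v * x) * y              ≈⟨ *-congʳ y combination ⟨
    d * y                            ≈⟨ *-congʳ y d≈c ⟩
    const (coeff d 0) * y            ∎)))
    where
    d≈c : d ≈ const (coeff d 0)
    d≈c = deg≡0⇒≈const d (trans (sym deg-d′) (∣1⇒deg≡0 d′ d′∣1))
    c≢0 : coeff d 0 ≢ 0ℤ
    c≢0 c≡0 = d≉[] (≈-trans d≈c (≈-trans (const-cong c≡0) 0∷[]≈[]))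
  -- Here `p/d` is a constant `c`, so `c d ≈ a p`; multiplying `b x ≈ d (x/d)` by `c` shows that `p`
  -- divides `c b x`.
  ... | inj₂ q′∣1 = inj₁ (primitive-∣ p x p-primitive (λ cb≡0 → Sum.[ c≢0 , b≢0 ] (ℤ.i*j≡0⇒i≡0∨j≡0 c cb≡0))
    (const a * x/d , (begin
      const a * x/d * p                ≈⟨ solve 3 (λ a w p → a ⊗ w ⊗ p ⊜ a ⊗ p ⊗ w) ≈-refl (const a) x/d p ⟩
      const a * p * x/d                ≈⟨ *-congʳ x/d (≈-trans d∣ap (*-congˡ d p/d≈c)) ⟩
      d * const c * x/d                ≈⟨ solve 3 (λ d c w → d ⊗ c ⊗ w ⊜ c ⊗ (d ⊗ w)) ≈-refl d (const c) x/d ⟩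
      const c * (d * x/d)              ≈⟨ *-congˡ (const c) d∣bx ⟨
      const c * (const b * x)          ≈⟨ *-assoc (const c) (const b) x ⟨
      const c * const b * x            ≈⟨ *-congʳ x (const-*-homo c b) ⟨
      const (c ℤ.* b) * x              ∎)))
    where
    c = coeff p/d 0
    p/d≈c : p/d ≈ const c
    p/d≈c = deg≡0⇒≈const p/d (trans (sym deg-q′) (∣1⇒deg≡0 q′ q′∣1))
    c≢0 : c ≢ 0ℤ
    c≢0 c≡0 = *≉[]⇒≉[]ʳ d (λ dq≈0 → p*q≉[] (const≉[] a≢0) p≉0 (≈-trans d∣ap dq≈0))
      (≈-trans p/d≈c (≈-trans (const-cong c≡0) 0∷[]≈[]))

-- Linear substitutions

open import Algebra.Properties.CommutativeSemiring.Exp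
  (CommutativeRing.commutativeSemiring ℤ[t]-commutativeRing)
  using (^-congˡ; ^-homo-*; ^-assocʳ; ^-distrib-*)

-- ∑ pᵢ wᵢ: composition is the case wᵢ = gⁱ, homogenisation the case wᵢ = xⁱ yᵉ⁻ⁱ.
linear : Poly → (ℕ → Poly) → Poly
linear []      w = []
linear (c ∷ p) w = const c * w 0 + linear p (w ⊚ suc)

const0-* : ∀ p → const 0ℤ * p ≈ []
const0-* p = *-congʳ p 0∷[]≈[]

linear-≈[] : ∀ {p} w → p ≈ [] → linear p w ≈ []
linear-≈[] {[]}    w _   = ≈-refl
linear-≈[] {c ∷ p} w p≈0 =
  +-cong (≈-trans (*-congʳ (w 0) (const-cong (coeff-≡ p≈0 0))) (const0-* (w 0)))
         (linear-≈[] {p} (w ⊚ suc) (≈-tail-[] p≈0))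

linear-congˡ : ∀ p q w → p ≈ q → linear p w ≈ linear q w
linear-congˡ []      q       w p≈q = ≈-sym (linear-≈[] {q} w (≈-sym p≈q))
linear-congˡ (c ∷ p) []      w p≈q = linear-≈[] {c ∷ p} w p≈q
linear-congˡ (c ∷ p) (d ∷ q) w p≈q =
  +-cong (*-congʳ (w 0) (const-cong (coeff-≡ p≈q 0))) (linear-congˡ p q (w ⊚ suc) (≈-tail p≈q))

linear-congʳ : ∀ p {w w′ d} → p deg< d → (∀ i → i < d → w i ≈ w′ i) → linear p w ≈ linear p w′
linear-congʳ []      _ _ = ≈-refl
linear-congʳ (c ∷ p) {w} {w′} {zero}  p<0 w≈ =
  ≈-trans (linear-≈[] {c ∷ p} w (deg<0⇒≈[] p<0)) (≈-sym (linear-≈[] {c ∷ p} w′ (deg<0⇒≈[] p<0)))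
linear-congʳ (c ∷ p) {w} {w′} {suc d} p<d w≈ =
  +-cong (*-congˡ (const c) (w≈ 0 z<s)) (linear-congʳ p (deg<-tail p<d) λ i i<d → w≈ (suc i) (s<s i<d))

linear-+ : ∀ p q w → linear (p + q) w ≈ linear p w + linear q w
linear-+ []      q       w = ≈-refl
linear-+ (c ∷ p) []      w = ≈-sym (+-identityʳ _)
linear-+ (c ∷ p) (d ∷ q) w = begin
  const (c ℤ.+ d) * w 0 + linear (p + q) (w ⊚ suc)                                ≈⟨ +-cong (*-distribʳ-+ (w 0) (const c) (const d)) (linear-+ p q (w ⊚ suc)) ⟩
  (const c * w 0 + const d * w 0) + (linear p (w ⊚ suc) + linear q (w ⊚ suc))     ≈⟨ +-interchange (const c * w 0) (const d * w 0) _ _ ⟩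
  linear (c ∷ p) w + linear (d ∷ q) w                                             ∎

linear-· : ∀ c p w → linear (c · p) w ≈ const c * linear p w
linear-· c []      w = ≈-sym 0∷[]≈[]
linear-· c (d ∷ p) w = begin
  const (c ℤ.* d) * w 0 + linear (c · p) (w ⊚ suc)          ≈⟨ +-cong (*-congʳ (w 0) (const-*-homo c d)) (linear-· c p (w ⊚ suc)) ⟩
  const c * const d * w 0 + const c * linear p (w ⊚ suc)    ≈⟨ solve 4 (λ c d w l → c ⊗ d ⊗ w ⊕ c ⊗ l ⊜ c ⊗ (d ⊗ w ⊕ l))
                                                                 ≈-refl (const c) (const d) (w 0) (linear p (w ⊚ suc)) ⟩
  const c * linear (d ∷ p) w                                ∎

linear-scale : ∀ p w x → linear p (λ i → x * w i) ≈ x * linear p w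
linear-scale []      w x = ≈-sym (*-zeroʳ x)
linear-scale (c ∷ p) w x = begin
  const c * (x * w 0) + linear p (λ i → x * w (suc i))    ≈⟨ +-congˡ (const c * (x * w 0)) (linear-scale p (w ⊚ suc) x) ⟩
  const c * (x * w 0) + x * linear p (w ⊚ suc)            ≈⟨ solve 4 (λ c x w l → c ⊗ (x ⊗ w) ⊕ x ⊗ l ⊜ x ⊗ (c ⊗ w ⊕ l))
                                                               ≈-refl (const c) x (w 0) (linear p (w ⊚ suc)) ⟩
  x * linear (c ∷ p) w                                    ∎

-- Multiplicativity of the weights is asked for below the degree bounds and no further, because in
-- the homogenisation the truncated exponents `e ∸ i` add up correctly only for `i ≤ e`.
linear-* : ∀ p q {u v w d e} → p deg< d → q deg< e →
           (∀ i j → i < d → j < e → w (i ℕ.+ j) ≈ u i * v j) →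
           linear (p * q) w ≈ linear p u * linear q v
linear-* []      q _ _ _ = ≈-refl
linear-* (c ∷ p) q {u} {v} {w} {zero} p<0 q<e w≈ = begin
  linear ((c ∷ p) * q) w             ≈⟨ linear-congˡ ((c ∷ p) * q) [] w (*-congʳ q (deg<0⇒≈[] p<0)) ⟩
  [] * linear q v                    ≈⟨ *-congʳ (linear q v) (linear-≈[] {c ∷ p} u (deg<0⇒≈[] p<0)) ⟨
  linear (c ∷ p) u * linear q v      ∎
linear-* (c ∷ p) q {u} {v} {w} {suc d} p<d q<e w≈ = begin
  linear (c · q + (0ℤ ∷ p * q)) w                                      ≈⟨ linear-+ (c · q) (0ℤ ∷ p * q) w ⟩
  linear (c · q) w + (const 0ℤ * w 0 + linear (p * q) (w ⊚ suc))       ≈⟨ +-cong (linear-· c q w) (+-congʳ (linear (p * q) (w ⊚ suc)) (const0-* (w 0))) ⟩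
  const c * linear q w + linear (p * q) (w ⊚ suc)                      ≈⟨ +-cong
      (*-congˡ (const c) (≈-trans (linear-congʳ q q<e λ j j<e → w≈ 0 j z<s j<e) (linear-scale q v (u 0))))
      (linear-* p q (deg<-tail p<d) q<e λ i j i<d j<e → w≈ (suc i) j (s<s i<d) j<e) ⟩
  const c * (u 0 * linear q v) + linear p (u ⊚ suc) * linear q v       ≈⟨ solve 4 (λ c u l k → c ⊗ (u ⊗ l) ⊕ k ⊗ l ⊜ (c ⊗ u ⊕ k) ⊗ l)
                                                                            ≈-refl (const c) (u 0) (linear q v) (linear p (u ⊚ suc)) ⟩
  linear (c ∷ p) u * linear q v                                        ∎

deg<-const-* : ∀ c p {d} → p deg< d → const c * p deg< d
deg<-const-* c p p<d n d≤n = trans (coeff-const-* c p n) (trans (cong (c ℤ.*_) (p<d n d≤n)) (ℤ.*-zeroʳ c))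

linear-deg< : ∀ p w {d e} → p deg< d → (∀ i → i < d → w i deg< e) → linear p w deg< e
linear-deg< []      w _ _ _ _ = refl
linear-deg< (c ∷ p) w {zero}  p<0 _ n _ = coeff-≡ (linear-≈[] {c ∷ p} w (deg<0⇒≈[] p<0)) n
linear-deg< (c ∷ p) w {suc d} p<d w<e = deg<-+ (const c * w 0) (linear p (w ⊚ suc))
  (deg<-const-* c (w 0) (w<e 0 z<s))
  (linear-deg< p (w ⊚ suc) (deg<-tail p<d) λ i i<d → w<e (suc i) (s<s i<d))

^-deg< : ∀ p {d} n → p deg< suc d → p ^ n deg< suc (n ℕ.* d)
^-deg< p zero    _   = const-deg<1 1ℤ
^-deg< p (suc n) p<d = deg<-* p (p ^ n) p<d (^-deg< p n p<d)

-- Composition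

∘-linear : ∀ p g → p ∘ g ≈ linear p (g ^_)
∘-linear []      g = ≈-refl
∘-linear (c ∷ p) g = +-cong (≈-sym (*-identityʳ (const c)))
  (≈-trans (*-congˡ g (∘-linear p g)) (≈-sym (linear-scale p (g ^_) g)))

∘-congˡ : ∀ {p q} g → p ≈ q → p ∘ g ≈ q ∘ g
∘-congˡ {p} {q} g p≈q = ≈-trans (∘-linear p g) (≈-trans (linear-congˡ p q (g ^_) p≈q) (≈-sym (∘-linear q g)))

∘-congʳ : ∀ p {g h} → g ≈ h → p ∘ g ≈ p ∘ h
∘-congʳ []      g≈h = ≈-refl
∘-congʳ (c ∷ p) g≈h = +-congˡ (const c) (*-cong g≈h (∘-congʳ p g≈h))

∘-+ : ∀ p q g → (p + q) ∘ g ≈ p ∘ g + q ∘ g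
∘-+ p q g = begin
  (p + q) ∘ g                            ≈⟨ ∘-linear (p + q) g ⟩
  linear (p + q) (g ^_)                  ≈⟨ linear-+ p q (g ^_) ⟩
  linear p (g ^_) + linear q (g ^_)      ≈⟨ +-cong (∘-linear p g) (∘-linear q g) ⟨
  p ∘ g + q ∘ g                          ∎

∘-* : ∀ p q g → (p * q) ∘ g ≈ (p ∘ g) * (q ∘ g)
∘-* p q g = begin
  (p * q) ∘ g                            ≈⟨ ∘-linear (p * q) g ⟩
  linear (p * q) (g ^_)                  ≈⟨ linear-* p q (deg<-deg p) (deg<-deg q) (λ i j _ _ → ^-homo-* g i j) ⟩
  linear p (g ^_) * linear q (g ^_)      ≈⟨ *-cong (∘-linear p g) (∘-linear q g) ⟨
  (p ∘ g) * (q ∘ g)                      ∎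

const-∘ : ∀ c g → const c ∘ g ≈ const c
const-∘ c g = ≈-trans (+-congˡ (const c) (*-zeroʳ g)) (+-identityʳ (const c))

∘-‿- : ∀ p g → (- p) ∘ g ≈ - (p ∘ g)
∘-‿- []      g = ≈-refl
∘-‿- (c ∷ p) g = begin
  const (ℤ.- c) + g * ((- p) ∘ g)      ≈⟨ +-congˡ (const (ℤ.- c)) (*-congˡ g (∘-‿- p g)) ⟩
  - const c + g * - (p ∘ g)            ≈⟨ solve 3 (λ c g h → ⊝ c ⊕ g ⊗ ⊝ h ⊜ ⊝ (c ⊕ g ⊗ h)) ≈-refl (const c) g (p ∘ g) ⟩
  - (const c + g * (p ∘ g))            ∎

∘-- : ∀ p q g → (p - q) ∘ g ≈ p ∘ g - q ∘ g
∘-- p q g = ≈-trans (∘-+ p (- q) g) (+-congˡ (p ∘ g) (∘-‿- q g))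

t∘ : ∀ g → t ∘ g ≈ g
t∘ g = begin
  const 0ℤ + g * (const 1ℤ ∘ g)      ≈⟨ +-cong 0∷[]≈[] (*-congˡ g (const-∘ 1ℤ g)) ⟩
  g * const 1ℤ                       ≈⟨ *-identityʳ g ⟩
  g                                  ∎

∘-^ : ∀ p n g → (p ^ n) ∘ g ≈ (p ∘ g) ^ n
∘-^ p zero    g = const-∘ 1ℤ g
∘-^ p (suc n) g = ≈-trans (∘-* p (p ^ n) g) (*-congˡ (p ∘ g) (∘-^ p n g))

t^∘ : ∀ n g → (t ^ n) ∘ g ≈ g ^ n
t^∘ n g = ≈-trans (∘-^ t n g) (^-congˡ n (t∘ g))

∘-assoc : ∀ p g h → (p ∘ g) ∘ h ≈ p ∘ (g ∘ h)
∘-assoc []      g h = ≈-refl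
∘-assoc (c ∷ p) g h = begin
  (const c + g * (p ∘ g)) ∘ h                    ≈⟨ ∘-+ (const c) (g * (p ∘ g)) h ⟩
  const c ∘ h + (g * (p ∘ g)) ∘ h                ≈⟨ +-cong (const-∘ c h) (∘-* g (p ∘ g) h) ⟩
  const c + (g ∘ h) * ((p ∘ g) ∘ h)              ≈⟨ +-congˡ (const c) (*-congˡ (g ∘ h) (∘-assoc p g h)) ⟩
  const c + (g ∘ h) * (p ∘ (g ∘ h))              ∎

∘-deg< : ∀ p g {m n} → p deg< suc m → g deg< suc n → p ∘ g deg< suc (m ℕ.* n)
∘-deg< p g {m} {n} p<m g<n = deg<-resp-≈ (≈-sym (∘-linear p g)) (linear-deg< p (g ^_) p<m λ i i<m →
  deg<-mono {g ^ i} (s≤s (ℕ.*-monoˡ-≤ n (ℕ.s≤s⁻¹ i<m))) (^-deg< g i g<n))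

-- Homogenisation

homogenise : ℕ → Poly → Poly → Poly → Poly
homogenise e p x y = linear p λ i → x ^ i * y ^ (e ℕ.∸ i)

homogenise-* : ∀ d e p q x y → p deg< suc d → q deg< suc e →
               homogenise (d ℕ.+ e) (p * q) x y ≈ homogenise d p x y * homogenise e q x y
homogenise-* d e p q x y p<d q<e = linear-* p q p<d q<e λ i j i<d j<e → begin
  x ^ (i ℕ.+ j) * y ^ (d ℕ.+ e ℕ.∸ (i ℕ.+ j))            ≡⟨ cong (λ k → x ^ (i ℕ.+ j) * y ^ k) (exponent (ℕ.s≤s⁻¹ i<d) (ℕ.s≤s⁻¹ j<e)) ⟩
  x ^ (i ℕ.+ j) * y ^ ((d ℕ.∸ i) ℕ.+ (e ℕ.∸ j))          ≈⟨ *-cong (^-homo-* x i j) (^-homo-* y (d ℕ.∸ i) (e ℕ.∸ j)) ⟩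
  x ^ i * x ^ j * (y ^ (d ℕ.∸ i) * y ^ (e ℕ.∸ j))        ≈⟨ solve 4 (λ a b c d → a ⊗ b ⊗ (c ⊗ d) ⊜ a ⊗ c ⊗ (b ⊗ d))
                                                              ≈-refl (x ^ i) (x ^ j) (y ^ (d ℕ.∸ i)) (y ^ (e ℕ.∸ j)) ⟩
  x ^ i * y ^ (d ℕ.∸ i) * (x ^ j * y ^ (e ℕ.∸ j))        ∎
  where
  exponent : ∀ {i j} → i ≤ d → j ≤ e → d ℕ.+ e ℕ.∸ (i ℕ.+ j) ≡ (d ℕ.∸ i) ℕ.+ (e ℕ.∸ j)
  exponent {i} {j} i≤d j≤e = trans (sym (ℕ.∸-+-assoc (d ℕ.+ e) i j))
    (trans (cong (ℕ._∸ j) (ℕ.+-∸-comm e i≤d)) (ℕ.+-∸-assoc (d ℕ.∸ i) j≤e))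

homogenise-deg< : ∀ e p x y {k} → p deg< suc e → x deg< suc k → y deg< suc k →
                  homogenise e p x y deg< suc (e ℕ.* k)
homogenise-deg< e p x y {k} p<e x<k y<k = linear-deg< p _ p<e λ i i<e →
  subst (λ n → x ^ i * y ^ (e ℕ.∸ i) deg< suc n)
    (trans (sym (ℕ.*-distribʳ-+ k i (e ℕ.∸ i))) (cong (ℕ._* k) (ℕ.m+[n∸m]≡n (ℕ.s≤s⁻¹ i<e))))
    (deg<-* (x ^ i) (y ^ (e ℕ.∸ i)) (^-deg< x i x<k) (^-deg< y (e ℕ.∸ i) y<k))

-- Cyclotomic factors

1ₚ : Poly
1ₚ = const 1ℤ

-₁-cong : ∀ {p q} → p ≈ q → p - 1ₚ ≈ q - 1ₚ
-₁-cong = +-congʳ (- 1ₚ)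

geometric : Poly → ℕ → Poly
geometric y zero    = []
geometric y (suc n) = 1ₚ + y * geometric y n

geometric-* : ∀ y n → geometric y n * (y - 1ₚ) ≈ y ^ n - 1ₚ
geometric-* y zero    = ≈-sym (-‿inverseʳ 1ₚ)
geometric-* y (suc n) = begin
  (1ₚ + y * geometric y n) * (y - 1ₚ)              ≈⟨ solve 2 (λ y g → (Κ 1ₚ ⊕ y ⊗ g) ⊗ (y ⊕ ⊝ Κ 1ₚ) ⊜ (y ⊕ ⊝ Κ 1ₚ) ⊕ y ⊗ (g ⊗ (y ⊕ ⊝ Κ 1ₚ)))
                                                        ≈-refl y (geometric y n) ⟩
  (y - 1ₚ) + y * (geometric y n * (y - 1ₚ))        ≈⟨ +-congˡ (y - 1ₚ) (*-congˡ y (geometric-* y n)) ⟩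
  (y - 1ₚ) + y * (y ^ n - 1ₚ)                      ≈⟨ solve 2 (λ y z → (y ⊕ ⊝ Κ 1ₚ) ⊕ y ⊗ (z ⊕ ⊝ Κ 1ₚ) ⊜ y ⊗ z ⊕ ⊝ Κ 1ₚ) ≈-refl y (y ^ n) ⟩
  y ^ suc n - 1ₚ                                   ∎

-- Modulo `y - 1` each of the `n` powers of `y` is 1. For `n = q` this supplies the constant that
-- primitivity later removes.
geometric-mod : ∀ y n → ∃ λ h → geometric y n ≈ const (+ n) + h * (y - 1ₚ)
geometric-mod y zero    = [] , ≈-sym (≈-trans (+-identityʳ _) 0∷[]≈[])
geometric-mod y (suc n) with geometric-mod y n
... | h , eq = const (+ n) + y * h , (begin
  1ₚ + y * geometric y n                                        ≈⟨ +-congˡ 1ₚ (*-congˡ y eq) ⟩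
  1ₚ + y * (const (+ n) + h * (y - 1ₚ))                         ≈⟨ solve 3 (λ y n h → Κ 1ₚ ⊕ y ⊗ (n ⊕ h ⊗ (y ⊕ ⊝ Κ 1ₚ)) ⊜ (Κ 1ₚ ⊕ n) ⊕ (n ⊕ y ⊗ h) ⊗ (y ⊕ ⊝ Κ 1ₚ))
                                                                     ≈-refl y (const (+ n)) h ⟩
  (1ₚ + const (+ n)) + (const (+ n) + y * h) * (y - 1ₚ)         ∎)

-- Bézout in the exponents: `y - 1` is `y^(1 + b n) - 1` minus `y (y^(b n) - 1)`, and each of these
-- powers minus one is a multiple of `y^m - 1` or `y^n - 1` by a geometric sum.
y-1-combination′ : ∀ y {m n} a b → 1 ℕ.+ b ℕ.* n ≡ a ℕ.* m →
                   ∃₂ λ u v → y - 1ₚ ≈ u * (y ^ m - 1ₚ) + v * (y ^ n - 1ₚ)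
y-1-combination′ y {m} {n} a b eq = u , - (y * v) , (begin
  y - 1ₚ                                                   ≈⟨ solve 2 (λ y z → y ⊕ ⊝ Κ 1ₚ ⊜ (y ⊗ z ⊕ ⊝ Κ 1ₚ) ⊕ ⊝ (y ⊗ (z ⊕ ⊝ Κ 1ₚ))) ≈-refl y (y ^ (b ℕ.* n)) ⟩
  (y ^ (1 ℕ.+ b ℕ.* n) - 1ₚ) - y * (y ^ (b ℕ.* n) - 1ₚ)    ≡⟨ cong (λ k → (y ^ k - 1ₚ) - y * (y ^ (b ℕ.* n) - 1ₚ)) eq ⟩
  (y ^ (a ℕ.* m) - 1ₚ) - y * (y ^ (b ℕ.* n) - 1ₚ)          ≈⟨ +-cong (power m a) (-‿cong (*-congˡ y (power n b))) ⟩
  u * (y ^ m - 1ₚ) - y * (v * (y ^ n - 1ₚ))                ≈⟨ solve 5 (λ u v y a b → u ⊗ a ⊕ ⊝ (y ⊗ (v ⊗ b)) ⊜ u ⊗ a ⊕ ⊝ (y ⊗ v) ⊗ b) ≈-refl u v y (y ^ m - 1ₚ) (y ^ n - 1ₚ) ⟩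
  u * (y ^ m - 1ₚ) + - (y * v) * (y ^ n - 1ₚ)              ∎)
  where
  u = geometric (y ^ m) a
  v = geometric (y ^ n) b

  power : ∀ n b → y ^ (b ℕ.* n) - 1ₚ ≈ geometric (y ^ n) b * (y ^ n - 1ₚ)
  power n b = begin
    y ^ (b ℕ.* n) - 1ₚ                       ≡⟨ cong (λ k → y ^ k - 1ₚ) (ℕ.*-comm b n) ⟩
    y ^ (n ℕ.* b) - 1ₚ                       ≈⟨ -₁-cong (^-assocʳ y n b) ⟨
    (y ^ n) ^ b - 1ₚ                         ≈⟨ geometric-* (y ^ n) b ⟨
    geometric (y ^ n) b * (y ^ n - 1ₚ)       ∎

y-1-combination : ∀ y {m n} → Coprime m n →
                  ∃₂ λ u v → y - 1ₚ ≈ u * (y ^ m - 1ₚ) + v * (y ^ n - 1ₚ)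
y-1-combination y {m} {n} m⊥n with ℕ.coprime-Bézout m⊥n
... | Bézout.+- a b eq = y-1-combination′ y a b eq
... | Bézout.-+ a b eq with y-1-combination′ y b a eq
...   | u , v , eq′ = v , u , ≈-trans eq′ (+-comm (u * (y ^ n - 1ₚ)) (v * (y ^ m - 1ₚ)))

∘-t^-assoc : ∀ p m n → (p ∘ (t ^ m)) ∘ (t ^ n) ≈ p ∘ (t ^ (n ℕ.* m))
∘-t^-assoc p m n = ≈-trans (∘-assoc p (t ^ m) (t ^ n))
  (∘-congʳ p (≈-trans (t^∘ m (t ^ n)) (^-assocʳ t n m)))

∘-t^-comm : ∀ p m n → (p ∘ (t ^ m)) ∘ (t ^ n) ≈ (p ∘ (t ^ n)) ∘ (t ^ m)
∘-t^-comm p m n = begin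
  (p ∘ (t ^ m)) ∘ (t ^ n)      ≈⟨ ∘-t^-assoc p m n ⟩
  p ∘ (t ^ (n ℕ.* m))          ≡⟨ cong (λ k → p ∘ (t ^ k)) (ℕ.*-comm n m) ⟩
  p ∘ (t ^ (m ℕ.* n))          ≈⟨ ∘-t^-assoc p n m ⟨
  (p ∘ (t ^ n)) ∘ (t ^ m)      ∎

tⁿ-1-∘ : ∀ n g → (t ^ n - 1ₚ) ∘ g ≈ g ^ n - 1ₚ
tⁿ-1-∘ n g = ≈-trans (∘-- (t ^ n) 1ₚ g) (+-cong (t^∘ n g) (-‿cong (const-∘ 1ℤ g)))

tⁿ-1-∘-t^ : ∀ n s → (t ^ n - 1ₚ) ∘ (t ^ s) ≈ t ^ (s ℕ.* n) - 1ₚ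
tⁿ-1-∘-t^ n s = ≈-trans (tⁿ-1-∘ n (t ^ s)) (-₁-cong (^-assocʳ t s n))

-- The constant term -1 shows both that `tⁿ - 1` is nonzero and that no prime divides any of its
-- divisors.
coeff₀-tⁿ-1 : ∀ n .{{_ : NonZero n}} → coeff (t ^ n - 1ₚ) 0 ≡ -1ℤ
coeff₀-tⁿ-1 (suc n) = trans (coeff-+ (t ^ suc n) (- 1ₚ) 0)
  (cong (λ x → x ℤ.+ -1ℤ) (coeff-*-zero 0ℤ (1ℤ ∷ []) (t ^ n)))

tⁿ-1≉[] : ∀ n .{{_ : NonZero n}} → ¬ t ^ n - 1ₚ ≈ []
tⁿ-1≉[] n tⁿ-1≈0 = contradiction (trans (sym (coeff₀-tⁿ-1 n)) (coeff-≡ tⁿ-1≈0 0)) λ ()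

∣-trans : ∀ {p q r} → p ∣ q → q ∣ r → p ∣ r
∣-trans {p} (a , ap≈q) (b , bq≈r) = b * a , ≈-trans (*-assoc b a p) (≈-trans (*-congˡ b ap≈q) bq≈r)

∣tⁿ-1⇒primitive : ∀ {p} n .{{_ : NonZero n}} → p ∣ t ^ n - 1ₚ → Primitive p
∣tⁿ-1⇒primitive {p} n p∣ {ℓ} ℓ-prime ℓ∣p = ℕ.¬prime[1] (subst ℕ.Prime (ℕ.∣1⇒≡1
  (ℤ∣.∣⇒∣ᵤ (subst (+ ℓ ℤ∣.∣_) (coeff₀-tⁿ-1 n) (const∣⇒coeffs∣ (∣-trans ℓ∣p p∣) 0)))) ℓ-prime)

-- The roots of p are mapped to roots of p by ζ ↦ ζˢ.
PowerStable : ℕ → Poly → Set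
PowerStable n p = ∀ s → Coprime s n → p ∣ p ∘ (t ^ s)

powerStable-* : ∀ {n} p q → PowerStable n p → PowerStable n q → PowerStable n (p * q)
powerStable-* p q p-stable q-stable s s⊥n with p-stable s s⊥n | q-stable s s⊥n
... | u , up≈ | v , vq≈ = u * v , (begin
  u * v * (p * q)                  ≈⟨ solve 4 (λ u v p q → u ⊗ v ⊗ (p ⊗ q) ⊜ u ⊗ p ⊗ (v ⊗ q)) ≈-refl u v p q ⟩
  u * p * (v * q)                  ≈⟨ *-cong up≈ vq≈ ⟩
  (p ∘ (t ^ s)) * (q ∘ (t ^ s))    ≈⟨ ∘-* p q (t ^ s) ⟨
  (p * q) ∘ (t ^ s)                ∎)

-- The substitutions of `t ^ q` and `t ^ s` commute, so the divisibility for `p` can be transported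
-- along `t ^ q`.
powerStable-∘ : ∀ {n} q p → PowerStable n p → PowerStable (q ℕ.* n) (p ∘ (t ^ q))
powerStable-∘ {n} q p p-stable s s⊥qn with p-stable s (coprime-*⁻ʳ q s⊥qn)
... | u , up≈ = u ∘ (t ^ q) , (begin
  (u ∘ (t ^ q)) * (p ∘ (t ^ q))    ≈⟨ ∘-* u p (t ^ q) ⟨
  (u * p) ∘ (t ^ q)                ≈⟨ ∘-congˡ (t ^ q) up≈ ⟩
  (p ∘ (t ^ s)) ∘ (t ^ q)          ≈⟨ ∘-t^-comm p s q ⟩
  (p ∘ (t ^ q)) ∘ (t ^ s)          ∎)

powerStable-tⁿ-1 : ∀ n → PowerStable n (t ^ n - 1ₚ)
powerStable-tⁿ-1 n s _ = geometric (t ^ n) s , (begin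
  geometric (t ^ n) s * (t ^ n - 1ₚ)   ≈⟨ geometric-* (t ^ n) s ⟩
  (t ^ n) ^ s - 1ₚ                     ≈⟨ -₁-cong (^-assocʳ t n s) ⟩
  t ^ (n ℕ.* s) - 1ₚ                   ≡⟨ cong (λ k → t ^ k - 1ₚ) (ℕ.*-comm n s) ⟩
  t ^ (s ℕ.* n) - 1ₚ                   ≈⟨ tⁿ-1-∘-t^ n s ⟨
  (t ^ n - 1ₚ) ∘ (t ^ s)               ∎)

-- The multipliers a with G ∣ a G(tˢ) include t^(s m) - 1 and t^(q m) - 1, hence
-- tᵐ - 1, and also G H, which is congruent to q modulo tᵐ - 1. So G ∣ q G(tˢ),
-- and G is primitive.
powerStable-quotient : ∀ {q m} .{{_ : NonZero m}} → ℕ.Prime q → ∀ F E G H →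
  F * E ≈ t ^ m - 1ₚ → G * F ≈ F ∘ (t ^ q) → G * H ≈ geometric (t ^ m) q →
  PowerStable m F → PowerStable (q ℕ.* m) G
powerStable-quotient {q} {m} q-prime F E G H FE≈ GF≈ GH≈ F-stable s s⊥qm =
  conclude (F-stable s (coprime-*⁻ʳ q s⊥qm)) (geometric-mod y q)
    (y-1-combination y {q} {s} (ℕ.sym (coprime-*⁻ˡ m s⊥qm)))
  where
  y A : Poly
  y = t ^ m
  A = G ∘ (t ^ s)

  F≉0 : ¬ F ≈ []
  F≉0 = *≉[]⇒≉[]ˡ E λ FE≈0 → tⁿ-1≉[] m (≈-trans (≈-sym FE≈) FE≈0)

  instance
    q≢0 = ℕ.prime⇒nonZero q-prime
    qm≢0 = ℕ.m*n≢0 q m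

  yᵃ-1 : ∀ a → y ^ a - 1ₚ ≈ t ^ (a ℕ.* m) - 1ₚ
  yᵃ-1 a = -₁-cong (≈-trans (^-assocʳ t m a) (mk≈ λ n → cong (λ k → coeff (t ^ k) n) (ℕ.*-comm m a)))

  GH[y-1]≈ : G * H * (y - 1ₚ) ≈ y ^ q - 1ₚ
  GH[y-1]≈ = ≈-trans (*-congʳ (y - 1ₚ) GH≈) (geometric-* y q)

  G-primitive : Primitive G
  G-primitive = ∣tⁿ-1⇒primitive (q ℕ.* m) (H * (y - 1ₚ) , (begin
    H * (y - 1ₚ) * G         ≈⟨ solve 3 (λ g h z → h ⊗ z ⊗ g ⊜ g ⊗ h ⊗ z) ≈-refl G H (y - 1ₚ) ⟩
    G * H * (y - 1ₚ)         ≈⟨ GH[y-1]≈ ⟩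
    y ^ q - 1ₚ               ≈⟨ yᵃ-1 q ⟩
    t ^ (q ℕ.* m) - 1ₚ       ∎))

  conclude : F ∣ F ∘ (t ^ s) → (∃ λ h → geometric y q ≈ const (+ q) + h * (y - 1ₚ)) →
             (∃₂ λ u v → y - 1ₚ ≈ u * (y ^ q - 1ₚ) + v * (y ^ s - 1ₚ)) → G ∣ A
  conclude (K , KF≈) (h , geometric≈) (u , v , y-1≈) =
    primitive-∣ {+ q} G A G-primitive (λ { refl → ℕ.¬prime[0] q-prime }) (B , (begin
      B * G                                                        ≈⟨ solve 8 (λ a g h k u v w x →
                                                                        (a ⊗ h ⊕ ⊝ (k ⊗ (u ⊗ w ⊕ v ⊗ x))) ⊗ g ⊜
                                                                        a ⊗ (g ⊗ h) ⊕ ⊝ (k ⊗ (u ⊗ (w ⊗ g) ⊕ v ⊗ (x ⊗ g))))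
                                                                        ≈-refl A G H h u v W₁ W₂ ⟩
      A * (G * H) - h * (u * (W₁ * G) + v * (W₂ * G))              ≈⟨ +-cong (*-congˡ A (≈-trans GH≈ geometric≈))
                                                                        (-‿cong (*-congˡ h (+-cong (*-congˡ u W₁G≈) (*-congˡ v W₂G≈)))) ⟩
      A * (const (+ q) + h * (y - 1ₚ)) - h * (u * (A * (y ^ q - 1ₚ)) + v * (A * (y ^ s - 1ₚ)))
                                                                   ≈⟨ solve 8 (λ a c h z u v w x →
                                                                        a ⊗ (c ⊕ h ⊗ z) ⊕ ⊝ (h ⊗ (u ⊗ (a ⊗ w) ⊕ v ⊗ (a ⊗ x))) ⊜
                                                                        c ⊗ a ⊕ h ⊗ a ⊗ (z ⊕ ⊝ (u ⊗ w ⊕ v ⊗ x)))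
                                                                        ≈-refl A (const (+ q)) h (y - 1ₚ) u v (y ^ q - 1ₚ) (y ^ s - 1ₚ) ⟩
      const (+ q) * A + h * A * ((y - 1ₚ) - (u * (y ^ q - 1ₚ) + v * (y ^ s - 1ₚ)))
                                                                   ≈⟨ +-congˡ (const (+ q) * A) (*-congˡ (h * A) (≈-trans
                                                                        (+-congʳ (- (u * (y ^ q - 1ₚ) + v * (y ^ s - 1ₚ))) y-1≈) (-‿inverseʳ (u * (y ^ q - 1ₚ) + v * (y ^ s - 1ₚ))))) ⟩
      const (+ q) * A + h * A * []                                 ≈⟨ +-congˡ (const (+ q) * A) (*-zeroʳ (h * A)) ⟩
      const (+ q) * A + []                                         ≈⟨ +-identityʳ _ ⟩
      const (+ q) * A                                              ∎))
    where
    K′ Eₛ W₁ W₂ B : Poly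
    K′ = K ∘ (t ^ q)
    Eₛ = E ∘ (t ^ s)
    W₁ = A * H * (y - 1ₚ)
    W₂ = K′ * F * Eₛ
    -- `G * H` is `q + h (y - 1)`, so `A * H` times `G` exceeds `q A` by `h A (y - 1)`. The
    -- combination `u W₁ + v W₂` is the cofactor that exhibits `A (y - 1)` as a multiple of `G`.
    B = A * H - h * (u * W₁ + v * W₂)

    -- After multiplication by `F`, both sides are `F` with `t ^ q` and `t ^ s` substituted, in the
    -- two possible orders.
    AK≈K′G : A * K ≈ K′ * G
    AK≈K′G = *-cancelˡ F (A * K) (K′ * G) F≉0 (begin
      F * (A * K)                            ≈⟨ solve 3 (λ f a k → f ⊗ (a ⊗ k) ⊜ a ⊗ (k ⊗ f)) ≈-refl F A K ⟩
      A * (K * F)                            ≈⟨ *-congˡ A KF≈ ⟩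
      (G ∘ (t ^ s)) * (F ∘ (t ^ s))          ≈⟨ ∘-* G F (t ^ s) ⟨
      (G * F) ∘ (t ^ s)                      ≈⟨ ∘-congˡ (t ^ s) GF≈ ⟩
      (F ∘ (t ^ q)) ∘ (t ^ s)                ≈⟨ ∘-t^-comm F q s ⟩
      (F ∘ (t ^ s)) ∘ (t ^ q)                ≈⟨ ∘-congˡ (t ^ q) KF≈ ⟨
      (K * F) ∘ (t ^ q)                      ≈⟨ ∘-* K F (t ^ q) ⟩
      K′ * (F ∘ (t ^ q))                     ≈⟨ *-congˡ K′ GF≈ ⟨
      K′ * (G * F)                           ≈⟨ solve 3 (λ k g f → k ⊗ (g ⊗ f) ⊜ f ⊗ (k ⊗ g)) ≈-refl K′ G F ⟩
      F * (K′ * G)                           ∎)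

    W₁G≈ : W₁ * G ≈ A * (y ^ q - 1ₚ)
    W₁G≈ = begin
      A * H * (y - 1ₚ) * G         ≈⟨ solve 4 (λ a h z g → a ⊗ h ⊗ z ⊗ g ⊜ a ⊗ (g ⊗ h ⊗ z)) ≈-refl A H (y - 1ₚ) G ⟩
      A * (G * H * (y - 1ₚ))       ≈⟨ *-congˡ A GH[y-1]≈ ⟩
      A * (y ^ q - 1ₚ)             ∎

    W₂G≈ : W₂ * G ≈ A * (y ^ s - 1ₚ)
    W₂G≈ = begin
      K′ * F * Eₛ * G                          ≈⟨ solve 4 (λ k f e g → k ⊗ f ⊗ e ⊗ g ⊜ k ⊗ g ⊗ f ⊗ e) ≈-refl K′ F Eₛ G ⟩
      K′ * G * F * Eₛ                          ≈⟨ *-congʳ Eₛ (*-congʳ F AK≈K′G) ⟨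
      A * K * F * Eₛ                           ≈⟨ solve 4 (λ a k f e → a ⊗ k ⊗ f ⊗ e ⊜ a ⊗ ((k ⊗ f) ⊗ e)) ≈-refl A K F Eₛ ⟩
      A * (K * F * Eₛ)                         ≈⟨ *-congˡ A (*-congʳ Eₛ KF≈) ⟩
      A * ((F ∘ (t ^ s)) * (E ∘ (t ^ s)))      ≈⟨ *-congˡ A (∘-* F E (t ^ s)) ⟨
      A * ((F * E) ∘ (t ^ s))                  ≈⟨ *-congˡ A (∘-congˡ (t ^ s) FE≈) ⟩
      A * ((t ^ m - 1ₚ) ∘ (t ^ s))             ≈⟨ *-congˡ A (tⁿ-1-∘-t^ m s) ⟩
      A * (t ^ (s ℕ.* m) - 1ₚ)                 ≈⟨ *-congˡ A (yᵃ-1 s) ⟨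
      A * (y ^ s - 1ₚ)                         ∎

-- Factors of `tⁿ - 1` of degree at most `φ n`

-- The divisor may be a product of several cyclotomic polynomials. Stability of the cofactor is part
-- of the invariant because the inductive step applies `powerStable-quotient` with the factor and
-- its cofactor in either role.
record CyclotomicFactor (n : ℕ) (p : Poly) : Set where
  field
    cofactor          : Poly
    p*cofactor≈tⁿ-1   : p * cofactor ≈ t ^ n - 1ₚ
    p-stable          : PowerStable n p
    cofactor-stable   : PowerStable n cofactor
    deg-≤φ            : deg p ≤ φ n

-- Models divisibility by a prime element, possibly after a multiplicative transformation of the
-- polynomial.
record PrimePredicate (P : Poly → Set) : Set where
  field
    respects : ∀ {p q} → p ≈ q → P p → P q
    split    : ∀ p q → P (p * q) → P p ⊎ P q

-- Says that `tⁿ - 1` splits into small factors without listing them: `P` traces a path down to one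
-- of them. Quantifying over all `P` lets the induction change the predicate.
HasCyclotomicFactors : ℕ → Set₁
HasCyclotomicFactors n = (P : Poly → Set) → PrimePredicate P → P (t ^ n - 1ₚ) →
                         ∃ λ p → CyclotomicFactor n p × P p

deg-∘-t^ : ∀ p n → deg (p ∘ (t ^ n)) ≤ n ℕ.* deg p
deg-∘-t^ p n = deg-≤ (p ∘ (t ^ n)) (subst (λ d → p ∘ (t ^ n) deg< suc d) (exponent)
  (∘-deg< p (t ^ n) (deg<-deg p) (^-deg< t n (deg<-deg t))))
  where
  exponent : deg p ℕ.* (n ℕ.* 1) ≡ n ℕ.* deg p
  exponent = trans (cong (deg p ℕ.*_) (ℕ.*-identityʳ n)) (ℕ.*-comm (deg p) n)

cyclotomicFactors-1 : HasCyclotomicFactors 1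
cyclotomicFactors-1 P _ P[t-1] = t ^ 1 - 1ₚ , record
  { cofactor        = 1ₚ
  ; p*cofactor≈tⁿ-1 = *-identityʳ (t ^ 1 - 1ₚ)
  ; p-stable        = powerStable-tⁿ-1 1
  ; cofactor-stable = λ s _ → 1ₚ , ≈-trans (*-identityˡ 1ₚ) (≈-sym (const-∘ 1ℤ (t ^ s)))
  ; deg-≤φ          = s≤s z≤n
  } , P[t-1]

∘-prime : ∀ {P} g → PrimePredicate P → PrimePredicate (λ p → P (p ∘ g))
∘-prime g P-prime = record
  { respects = λ p≈q → respects (∘-congˡ g p≈q)
  ; split    = λ p q Ppq → split (p ∘ g) (q ∘ g) (respects (∘-* p q g) Ppq)
  }
  where open PrimePredicate P-prime

-- Substituting `t ^ q` takes `tᵐ - 1` to the polynomial for `q * m`, so the induction hypothesis is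
-- applied to `P` pulled back along this substitution.
cyclotomicFactors-* : ∀ {q m} .{{_ : NonZero m}} → ℕ.Prime q →
                      HasCyclotomicFactors m → HasCyclotomicFactors (q ℕ.* m)
cyclotomicFactors-* {q} {m} q-prime ih P P-prime P[tqm-1] with ih (λ p → P (p ∘ (t ^ q))) (∘-prime (t ^ q) P-prime)
  (PrimePredicate.respects P-prime (≈-sym (tⁿ-1-∘-t^ m q)) P[tqm-1])
... | F , F-factor , P[F∘tq] = cases (q ℕ.∣? m)
  where
  open PrimePredicate P-prime
  open CyclotomicFactor F-factor
    renaming (cofactor to E; p*cofactor≈tⁿ-1 to FE≈; p-stable to F-stable; cofactor-stable to E-stable)

  Goal : Set
  Goal = ∃ λ p → CyclotomicFactor (q ℕ.* m) p × P p

  [FE]∘ : (F ∘ (t ^ q)) * (E ∘ (t ^ q)) ≈ t ^ (q ℕ.* m) - 1ₚ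
  [FE]∘ = begin
    (F ∘ (t ^ q)) * (E ∘ (t ^ q))    ≈⟨ ∘-* F E (t ^ q) ⟨
    (F * E) ∘ (t ^ q)                ≈⟨ ∘-congˡ (t ^ q) FE≈ ⟩
    (t ^ m - 1ₚ) ∘ (t ^ q)           ≈⟨ tⁿ-1-∘-t^ m q ⟩
    t ^ (q ℕ.* m) - 1ₚ               ∎

  FE≉0 : ¬ F * E ≈ []
  FE≉0 FE≈0 = tⁿ-1≉[] m (≈-trans (≈-sym FE≈) FE≈0)

  F≉0 : ¬ F ≈ []
  F≉0 = *≉[]⇒≉[]ˡ E FE≉0

  coprime-case : Coprime q m → F ∣ F ∘ (t ^ q) → E ∣ E ∘ (t ^ q) → Goal
  coprime-case q⊥m (G , GF≈) (H , HE≈) =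
    Sum.[ (λ P[G] → G , G-factor , P[G]) , (λ P[F] → F , F-factor′ , P[F]) ]
      (split G F (respects (≈-sym GF≈) P[F∘tq]))
    where
    product≈ : (G * H) * (F * E) ≈ t ^ (q ℕ.* m) - 1ₚ
    product≈ = begin
      G * H * (F * E)                  ≈⟨ solve 4 (λ g h f e → g ⊗ h ⊗ (f ⊗ e) ⊜ (g ⊗ f) ⊗ (h ⊗ e)) ≈-refl G H F E ⟩
      (G * F) * (H * E)                ≈⟨ *-cong GF≈ HE≈ ⟩
      (F ∘ (t ^ q)) * (E ∘ (t ^ q))    ≈⟨ [FE]∘ ⟩
      t ^ (q ℕ.* m) - 1ₚ               ∎

    GH≈ : G * H ≈ geometric (t ^ m) q
    GH≈ = *-cancelˡ (t ^ m - 1ₚ) (G * H) (geometric (t ^ m) q) (tⁿ-1≉[] m) (begin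
      (t ^ m - 1ₚ) * (G * H)                   ≈⟨ *-comm (t ^ m - 1ₚ) (G * H) ⟩
      G * H * (t ^ m - 1ₚ)                     ≈⟨ *-congˡ (G * H) FE≈ ⟨
      G * H * (F * E)                          ≈⟨ product≈ ⟩
      t ^ (q ℕ.* m) - 1ₚ                       ≡⟨ cong (λ k → t ^ k - 1ₚ) (ℕ.*-comm q m) ⟩
      t ^ (m ℕ.* q) - 1ₚ                       ≈⟨ -₁-cong (^-assocʳ t m q) ⟨
      (t ^ m) ^ q - 1ₚ                         ≈⟨ geometric-* (t ^ m) q ⟨
      geometric (t ^ m) q * (t ^ m - 1ₚ)       ≈⟨ *-comm (geometric (t ^ m) q) (t ^ m - 1ₚ) ⟩
      (t ^ m - 1ₚ) * geometric (t ^ m) q       ∎)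

    G-stable : PowerStable (q ℕ.* m) G
    G-stable = powerStable-quotient q-prime F E G H FE≈ GF≈ GH≈ F-stable

    -- The situation is symmetric: `E` and `H` take the places of `F` and `G`.
    H-stable : PowerStable (q ℕ.* m) H
    H-stable = powerStable-quotient q-prime E F H G (≈-trans (*-comm E F) FE≈) HE≈ (≈-trans (*-comm H G) GH≈) E-stable

    weaken : ∀ {p} → PowerStable m p → PowerStable (q ℕ.* m) p
    weaken p-stable s s⊥qm = p-stable s (coprime-*⁻ʳ q s⊥qm)

    G≉0 : ¬ G ≈ []
    G≉0 G≈0 = *≉[]⇒≉[]ˡ H (λ GH≈0 → tⁿ-1≉[] (q ℕ.* m) {{ℕ.m*n≢0 q m {{ℕ.prime⇒nonZero q-prime}}}}
      (≈-trans (≈-sym product≈) (*-congʳ (F * E) GH≈0))) G≈0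

    deg-G+deg-F≤ : deg G ℕ.+ deg F ≤ q ℕ.* deg F
    deg-G+deg-F≤ = ℕ.≤-trans (ℕ.≤-reflexive (trans (sym (deg-* G F G≉0 F≉0)) (deg-cong GF≈))) (deg-∘-t^ F q)

    2≤q : 2 ≤ q
    2≤q = ℕ.nonTrivial⇒n>1 q {{ℕ.prime⇒nonTrivial q-prime}}

    -- The chain `e ≤ (q - 1) d ≤ (q - 1) φ(m) ≤ φ(q m)`, with `q = suc q′` in place of a
    -- subtraction.
    [q-1]*φ≤φ : ∀ {d e} → d ≤ φ m → e ℕ.+ d ≤ q ℕ.* d → e ≤ φ (q ℕ.* m)
    [q-1]*φ≤φ {d} {e} d≤φ e+d≤qd = bound q refl
      where
      bound : ∀ q′ → q′ ≡ q → e ≤ φ (q ℕ.* m)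
      bound zero     refl = contradiction q-prime ℕ.¬prime[0]
      bound (suc q′) refl = ℕ.≤-trans
        (ℕ.+-cancelʳ-≤ d e (q′ ℕ.* d) (ℕ.≤-trans e+d≤qd (ℕ.≤-reflexive (ℕ.+-comm d (q′ ℕ.* d)))))
        (ℕ.≤-trans (ℕ.*-monoʳ-≤ q′ d≤φ)
          (ℕ.+-cancelʳ-≤ (φ m) (q′ ℕ.* φ m) (φ (q ℕ.* m))
            (ℕ.≤-trans (ℕ.≤-reflexive (ℕ.+-comm (q′ ℕ.* φ m) (φ m))) (*φ≤φ*+φ m q-prime))))

    G-factor : CyclotomicFactor (q ℕ.* m) G
    G-factor = record
      { cofactor        = H * (F * E)
      ; p*cofactor≈tⁿ-1 = ≈-trans (≈-sym (*-assoc G H (F * E))) product≈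
      ; p-stable        = G-stable
      ; cofactor-stable = powerStable-* H (F * E) H-stable (powerStable-* F E (weaken F-stable) (weaken E-stable))
      ; deg-≤φ          = [q-1]*φ≤φ deg-≤φ deg-G+deg-F≤
      }

    F-factor′ : CyclotomicFactor (q ℕ.* m) F
    F-factor′ = record
      { cofactor        = G * H * E
      ; p*cofactor≈tⁿ-1 = ≈-trans (solve 4 (λ g h f e → f ⊗ (g ⊗ h ⊗ e) ⊜ (g ⊗ h) ⊗ (f ⊗ e)) ≈-refl G H F E) product≈
      ; p-stable        = weaken F-stable
      ; cofactor-stable = powerStable-* (G * H) E (powerStable-* G H G-stable H-stable) (weaken E-stable)
      -- `F` meets the same bound as `G`, since `q ≥ 2` gives `deg F + deg F ≤ q * deg F`.
      ; deg-≤φ          = [q-1]*φ≤φ deg-≤φ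
          (ℕ.≤-trans (ℕ.≤-reflexive (cong (deg F ℕ.+_) (sym (ℕ.+-identityʳ (deg F))))) (ℕ.*-monoˡ-≤ (deg F) 2≤q))
      }

  divides-case : q ℕ.∣ m → Goal
  divides-case q∣m = F ∘ (t ^ q) , record
    { cofactor        = E ∘ (t ^ q)
    ; p*cofactor≈tⁿ-1 = [FE]∘
    ; p-stable        = powerStable-∘ q F F-stable
    ; cofactor-stable = powerStable-∘ q E E-stable
    ; deg-≤φ          = ℕ.≤-trans (deg-∘-t^ F q) (ℕ.≤-trans (ℕ.*-monoʳ-≤ q deg-≤φ) (*φ≤φ* q-prime q∣m))
    } , P[F∘tq]

  cases : _ → Goal
  cases (yes q∣m) = divides-case q∣m
  -- Now `q` itself is an admissible exponent, and stability at `s = q` supplies the quotients `G`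
  -- and `H`.
  cases (no  q∤m) = coprime-case q⊥m (F-stable q q⊥m) (E-stable q q⊥m)
    where q⊥m = prime∤⇒coprime q-prime q∤m

cyclotomicFactors : ∀ n .{{_ : NonZero n}} → HasCyclotomicFactors n
-- The motive includes `NonZero` because the step divides by `tᵐ - 1`; `m` inherits it from `q * m`.
cyclotomicFactors n = prime-induction (λ n → NonZero n → HasCyclotomicFactors n)
  (λ _ → cyclotomicFactors-1)
  (λ {q} {m} q-prime ih qm≢0 → let m≢0 = ℕ.m*n≢0⇒n≢0 q {{qm≢0}} in cyclotomicFactors-* {{m≢0}} q-prime (ih m≢0))
  n (ℕ.≢-nonZero (ℕ.≢-nonZero⁻¹ n))

-- Irreducible factors of xⁿ - yⁿ

deg-+ˡ : ∀ p q {d} → deg p ≡ suc d → q deg< suc d → deg (p + q) ≡ suc d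
deg-+ˡ p q {d} deg-p q<d = deg-unique (p + q)
  (λ eq → coeff-deg≢0 p p≉0 (trans (cong (coeff p) deg-p) (trans (sym top) eq)))
  (deg<-+ p q (subst (λ e → p deg< suc e) deg-p (deg<-deg p)) (deg<-mono {q} (ℕ.n≤1+n _) q<d))
  where
  p≉0 : ¬ p ≈ []
  p≉0 p≈0 = contradiction (trans (sym deg-p) (deg-cong p≈0)) λ ()

  top : coeff (p + q) (suc d) ≡ coeff p (suc d)
  top = trans (coeff-+ p q (suc d))
    (trans (cong (λ x → coeff p (suc d) ℤ.+ x) (q<d (suc d) ℕ.≤-refl)) (ℤ.+-identityʳ _))

1ₚ≉[] : ¬ 1ₚ ≈ []
1ₚ≉[] = const≉[] λ ()

^≉[] : ∀ p n → ¬ p ≈ [] → ¬ p ^ n ≈ []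
^≉[] p zero    p≉0 = 1ₚ≉[]
^≉[] p (suc n) p≉0 = p*q≉[] {p} {p ^ n} p≉0 (^≉[] p n p≉0)

deg-^ : ∀ p n → ¬ p ≈ [] → deg (p ^ n) ≡ n ℕ.* deg p
deg-^ p zero    p≉0 = refl
deg-^ p (suc n) p≉0 = trans (deg-* p (p ^ n) p≉0 (^≉[] p n p≉0)) (cong (deg p ℕ.+_) (deg-^ p n p≉0))

t≉[] : ¬ t ≈ []
t≉[] t≈0 = contradiction (coeff-≡ t≈0 1) λ ()

deg-t^ : ∀ n → deg (t ^ n) ≡ n
deg-t^ n = trans (deg-^ t n t≉[]) (ℕ.*-identityʳ n)

t^-deg< : ∀ n → t ^ n deg< suc n
t^-deg< n = subst (λ d → t ^ n deg< suc d) (deg-t^ n) (deg<-deg (t ^ n))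

deg-tⁿ-1 : ∀ n .{{_ : NonZero n}} → deg (t ^ n - 1ₚ) ≡ n
deg-tⁿ-1 (suc n) = deg-+ˡ (t ^ suc n) (- 1ₚ) (deg-t^ (suc n))
  (deg<-mono { - 1ₚ} (s≤s z≤n) (deg<-‿- 1ₚ (const-deg<1 1ℤ)))

∣⇒deg≤ : ∀ p q → p ∣ q → ¬ q ≈ [] → deg p ≤ deg q
∣⇒deg≤ p q (r , rp≈q) q≉0 = ℕ.≤-trans (ℕ.m≤n+m (deg p) (deg r))
  (ℕ.≤-reflexive (trans (sym (deg-* r p (*≉[]⇒≉[]ˡ p rp≉0) (*≉[]⇒≉[]ʳ r rp≉0))) (deg-cong rp≈q)))
  where
  rp≉0 : ¬ r * p ≈ []
  rp≉0 rp≈0 = q≉0 (≈-trans (≈-sym rp≈q) rp≈0)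

linear-t^ : ∀ n w → linear (t ^ n) w ≈ w n
linear-t^ zero    w = ≈-trans (+-identityʳ _) (*-identityˡ (w 0))
linear-t^ (suc n) w = begin
  linear (t * t ^ n) w                         ≈⟨ linear-congˡ (t * t ^ n) (0ℤ ∷ t ^ n) w t*tⁿ≈ ⟩
  const 0ℤ * w 0 + linear (t ^ n) (w ⊚ suc)    ≈⟨ +-cong (const0-* (w 0)) (linear-t^ n (w ⊚ suc)) ⟩
  w (suc n)                                    ∎
  where
  t*tⁿ≈ : t * t ^ n ≈ 0ℤ ∷ t ^ n
  t*tⁿ≈ = ≈-trans (0∷-* 1ₚ (t ^ n)) (∷-cong refl (*-identityˡ (t ^ n)))

homogenise-tⁿ-1 : ∀ n x y → homogenise n (t ^ n - 1ₚ) x y ≈ x ^ n - y ^ n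
homogenise-tⁿ-1 n x y = begin
  linear (t ^ n - 1ₚ) w                        ≈⟨ linear-+ (t ^ n) (- 1ₚ) w ⟩
  linear (t ^ n) w + (- 1ₚ * w 0 + [])         ≈⟨ +-cong (linear-t^ n w) (+-identityʳ (- 1ₚ * w 0)) ⟩
  x ^ n * y ^ (n ∸ n) + - 1ₚ * (1ₚ * y ^ n)    ≡⟨ cong (λ k → x ^ n * y ^ k + - 1ₚ * (1ₚ * y ^ n)) (ℕ.n∸n≡0 n) ⟩
  x ^ n * 1ₚ + - 1ₚ * (1ₚ * y ^ n)             ≈⟨ solve 2 (λ a b → a ⊗ Κ 1ₚ ⊕ (⊝ Κ 1ₚ) ⊗ (Κ 1ₚ ⊗ b) ⊜ a ⊕ ⊝ b) ≈-refl (x ^ n) (y ^ n) ⟩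
  x ^ n - y ^ n                                ∎
  where
  w : ℕ → Poly
  w i = x ^ i * y ^ (n ∸ i)

homogenise-congˡ : ∀ {p q} e x y → p ≈ q → homogenise e p x y ≈ homogenise e q x y
homogenise-congˡ {p} {q} e x y = linear-congˡ p q _

-- The two powers have different degrees, since `deg y < deg x`.
xⁿ-yⁿ≉[] : ∀ x y n .{{_ : NonZero n}} → deg y < deg x → ¬ x ^ n - y ^ n ≈ []
xⁿ-yⁿ≉[] x y n y<x xⁿ-yⁿ≈0 = ℕ.<⇒≢ (ℕ.≤-<-trans (deg-≤ (y ^ n) (^-deg< y n (deg<-deg y))) (ℕ.*-monoʳ-< n y<x))
  (trans (sym (deg-cong (p-q≈[]⇒p≈q (x ^ n) (y ^ n) xⁿ-yⁿ≈0))) (deg-^ x n λ x≈0 → ℕ.<⇒≱ y<x (ℕ.≤-trans (ℕ.≤-reflexive (deg-cong x≈0)) z≤n)))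

-- Homogenising each polynomial at its exact degree is multiplicative and `p` is prime, so
-- `p ∣ homogenised f` is a `PrimePredicate` in `f`. It selects a factor `f` with `deg f ≤ φ n`;
-- `homogenised f` is nonzero of degree at most `φ n * k`, and `p` divides it.
irreducibleFactor-deg : ∀ {p} n .{{_ : NonZero n}} k x y → x deg< suc k → y deg< suc k → deg y < deg x →
                        Irreducible p → 0 < deg p → p ∣ x ^ n - y ^ n → deg p ≤ φ n ℕ.* k
irreducibleFactor-deg {p} n k x y x<k y<k y<x p-irred 0<deg p∣ = bound (cyclotomicFactors n P P-prime P[tⁿ-1])
  where
  homogenised : Poly → Poly
  homogenised f = homogenise (deg f) f x y

  P : Poly → Set
  P f = p ∣ homogenised f

  homogenised-cong : ∀ {f g} → f ≈ g → homogenised f ≈ homogenised g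
  homogenised-cong {f} {g} f≈g rewrite deg-cong f≈g = homogenise-congˡ (deg g) x y f≈g

  homogenised-* : ∀ f g → ¬ f ≈ [] → ¬ g ≈ [] → homogenised (f * g) ≈ homogenised f * homogenised g
  homogenised-* f g f≉0 g≉0 rewrite deg-* f g f≉0 g≉0 =
    homogenise-* (deg f) (deg g) f g x y (deg<-deg f) (deg<-deg g)

  homogenised-tⁿ-1 : homogenised (t ^ n - 1ₚ) ≈ x ^ n - y ^ n
  homogenised-tⁿ-1 = subst (λ d → homogenise d (t ^ n - 1ₚ) x y ≈ x ^ n - y ^ n) (sym (deg-tⁿ-1 n))
    (homogenise-tⁿ-1 n x y)

  P-≈[] : ∀ {f} → f ≈ [] → P f
  P-≈[] {f} f≈0 = [] , ≈-sym (homogenised-cong f≈0)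

  -- Degrees add for nonzero factors; a zero factor is handled apart, its homogenisation being zero
  -- and hence a multiple of `p`.
  split : ∀ f g → P (f * g) → P f ⊎ P g
  split f g P[fg] with f ≈[]? | g ≈[]?
  ... | yes f≈0 | _       = inj₁ (P-≈[] f≈0)
  ... | no  _   | yes g≈0 = inj₂ (P-≈[] g≈0)
  ... | no  f≉0 | no g≉0  = irreducible⇒prime p-irred 0<deg (homogenised f) (homogenised g)
    (∣-resp-≈ (homogenised-* f g f≉0 g≉0) P[fg])

  P-prime : PrimePredicate P
  P-prime = record { respects = λ f≈g → ∣-resp-≈ (homogenised-cong f≈g) ; split = split }

  P[tⁿ-1] : P (t ^ n - 1ₚ)
  P[tⁿ-1] = ∣-resp-≈ (≈-sym homogenised-tⁿ-1) p∣

  bound : (∃ λ f → CyclotomicFactor n f × P f) → deg p ≤ φ n ℕ.* k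
  bound (f , f-factor , P[f]) = ℕ.≤-trans (∣⇒deg≤ p (homogenised f) P[f] homogenised≉0)
    (ℕ.≤-trans (deg-≤ (homogenised f) (homogenise-deg< (deg f) f x y (deg<-deg f) x<k y<k)) (ℕ.*-monoˡ-≤ k deg-≤φ))
    where
    open CyclotomicFactor f-factor renaming (cofactor to e; p*cofactor≈tⁿ-1 to fe≈)

    fe≉0 : ¬ f * e ≈ []
    fe≉0 fe≈0 = tⁿ-1≉[] n (≈-trans (≈-sym fe≈) fe≈0)

    homogenised≉0 : ¬ homogenised f ≈ []
    homogenised≉0 = *≉[]⇒≉[]ˡ (homogenised e) λ product≈0 → xⁿ-yⁿ≉[] x y n y<x (begin
      x ^ n - y ^ n                      ≈⟨ homogenised-tⁿ-1 ⟨
      homogenised (t ^ n - 1ₚ)           ≈⟨ homogenised-cong fe≈ ⟨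
      homogenised (f * e)                ≈⟨ homogenised-* f e (*≉[]⇒≉[]ˡ e fe≉0) (*≉[]⇒≉[]ʳ f fe≉0) ⟩
      homogenised f * homogenised e      ≈⟨ product≈0 ⟩
      []                                 ∎)

-- Polysmoothness of the two families

admitsPolysmoothness : ∀ f g c n .{{_ : NonZero n}} k x y → f ∘ g ≈ const c * (x ^ n - y ^ n) → c ≢ 0ℤ →
                       0 < k → deg f ≡ k → deg g ≡ n → x deg< suc k → y deg< suc k → deg y < deg x →
                       AdmitsPolysmoothness f (φ-ratio n)
admitsPolysmoothness f g c n k x y f∘g≈ c≢0 0<k refl refl x<k y<k y<x = record
  { f-positiveDegree = 0<k
  ; θ-nonNegative    = φ-ratio-nonNegative n
  ; g                = g
  ; g-nonConstant    = ℕ.>-nonZero⁻¹ n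
  ; smooth           = λ p p-irred p∣f∘g → fromℕ-≤-φ-ratio (deg p) n k (deg-bound p p-irred p∣f∘g (0 ℕ.<? deg p))
  }
  where
  deg-bound : ∀ p → Irreducible p → p ∣ f ∘ g → _ → deg p ≤ φ n ℕ.* k
  deg-bound p p-irred p∣ (no  0≮deg) = ℕ.≤-trans (ℕ.≮⇒≥ 0≮deg) z≤n
  deg-bound p p-irred p∣ (yes 0<deg) = irreducibleFactor-deg n k x y x<k y<k y<x p-irred 0<deg
    (primitive-∣ p (x ^ n - y ^ n) (irreducible⇒primitive p-irred 0<deg) c≢0 (∣-resp-≈ f∘g≈ p∣))

const*t^-∘ : ∀ a n g → (const a * t ^ n) ∘ g ≈ const a * g ^ n
const*t^-∘ a n g = ≈-trans (∘-* (const a) (t ^ n) g) (*-cong (const-∘ a g) (t^∘ n g))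

1^ : ∀ n → 1ₚ ^ n ≈ 1ₚ
1^ zero    = ≈-refl
1^ (suc n) = ≈-trans (*-identityˡ (1ₚ ^ n)) (1^ n)

t^k+at^[k-1]-b-admits : ∀ n a b → b ≢ 0ℤ →
         AdmitsPolysmoothness (t ^ (2 ℕ.+ n) + const a * t ^ (1 ℕ.+ n) - const b) (φ-ratio (1 ℕ.+ n))
t^k+at^[k-1]-b-admits n′ a b b≢0 = admitsPolysmoothness f g b n k (t * g) 1ₚ f∘g≈ b≢0 z<s deg-f deg-g
  (subst (λ d → t * g deg< suc d) deg-tg (deg<-deg (t * g)))
  (deg<-mono {1ₚ} (s≤s z≤n) (const-deg<1 1ℤ))
  (subst (0 <_) (sym deg-tg) z<s)
  where
  n = 1 ℕ.+ n′
  k = 1 ℕ.+ n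

  f g : Poly
  f = t ^ k + const a * t ^ n - const b
  g = const b * t ^ n - const a

  deg-f : deg f ≡ k
  deg-f = deg-+ˡ (t ^ k + const a * t ^ n) (- const b)
    (deg-+ˡ (t ^ k) (const a * t ^ n) (deg-t^ k) (deg<-const-* a (t ^ n) (t^-deg< n)))
    (deg<-mono { - const b} (s≤s z≤n) (deg<-‿- (const b) (const-deg<1 b)))

  deg-g : deg g ≡ n
  deg-g = deg-+ˡ (const b * t ^ n) (- const a) (trans (deg-const-* (t ^ n) b≢0) (deg-t^ n))
    (deg<-mono { - const a} (s≤s z≤n) (deg<-‿- (const a) (const-deg<1 a)))

  deg-tg : deg (t * g) ≡ k
  deg-tg = trans (deg-* t g t≉[] λ g≈0 → contradiction (trans (sym deg-g) (deg-cong g≈0)) λ ()) (cong suc deg-g)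

  f∘g≈ : f ∘ g ≈ const b * ((t * g) ^ n - 1ₚ ^ n)
  f∘g≈ = begin
    f ∘ g                                                       ≈⟨ ∘-- (t ^ k + const a * t ^ n) (const b) g ⟩
    (t ^ k + const a * t ^ n) ∘ g - const b ∘ g                 ≈⟨ +-cong (∘-+ (t ^ k) (const a * t ^ n) g) (-‿cong (const-∘ b g)) ⟩
    (t ^ k) ∘ g + (const a * t ^ n) ∘ g - const b               ≈⟨ +-congʳ (- const b) (+-cong (t^∘ k g) (const*t^-∘ a n g)) ⟩
    -- `g ^ k` unfolds to `g * g ^ n`. The solver sees the single `g` as `b T - a` and the power as
    -- an opaque `G`, so the terms `a G` cancel.
    g * g ^ n + const a * g ^ n - const b                       ≈⟨ solve 4 (λ a b T G → (b ⊗ T ⊕ ⊝ a) ⊗ G ⊕ a ⊗ G ⊕ ⊝ b ⊜ b ⊗ (T ⊗ G ⊕ ⊝ Κ 1ₚ))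
                                                                     ≈-refl (const a) (const b) (t ^ n) (g ^ n) ⟩
    const b * (t ^ n * g ^ n - 1ₚ)                              ≈⟨ *-congˡ (const b) (+-cong (^-distrib-* t g n) (-‿cong (1^ n))) ⟨
    const b * ((t * g) ^ n - 1ₚ ^ n)                            ∎

at^k-t+b-admits : ∀ n a b → a ≢ 0ℤ →
          AdmitsPolysmoothness (const a * t ^ (2 ℕ.+ n) - t + const b) (φ-ratio (2 ℕ.+ n))
at^k-t+b-admits n a b a≢0 = admitsPolysmoothness f g a k k g t f∘g≈ a≢0 z<s deg-f deg-g
  (subst (λ d → g deg< suc d) deg-g (deg<-deg g))
  (deg<-mono {t} (s≤s (s≤s z≤n)) (deg<-deg t))
  -- Here `k ≥ 2` enters: `t` must have smaller degree than `g`.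
  (subst (1 <_) (sym deg-g) 2≤k)
  where
  k = 2 ℕ.+ n

  2≤k : 2 ≤ k
  2≤k = s≤s (s≤s z≤n)

  f g : Poly
  f = const a * t ^ k - t + const b
  g = const a * t ^ k + const b

  deg-at^k : deg (const a * t ^ k) ≡ k
  deg-at^k = trans (deg-const-* (t ^ k) a≢0) (deg-t^ k)

  deg-f : deg f ≡ k
  deg-f = deg-+ˡ (const a * t ^ k - t) (const b)
    (deg-+ˡ (const a * t ^ k) (- t) deg-at^k (deg<-mono { - t} 2≤k (deg<-‿- t (deg<-deg t))))
    (deg<-mono {const b} (s≤s z≤n) (const-deg<1 b))

  deg-g : deg g ≡ k
  deg-g = deg-+ˡ (const a * t ^ k) (const b) deg-at^k (deg<-mono {const b} (s≤s z≤n) (const-deg<1 b))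

  f∘g≈ : f ∘ g ≈ const a * (g ^ k - t ^ k)
  f∘g≈ = begin
    f ∘ g                                                 ≈⟨ ∘-+ (const a * t ^ k - t) (const b) g ⟩
    (const a * t ^ k - t) ∘ g + const b ∘ g               ≈⟨ +-cong (∘-- (const a * t ^ k) t g) (const-∘ b g) ⟩
    (const a * t ^ k) ∘ g - t ∘ g + const b               ≈⟨ +-congʳ (const b) (+-cong (const*t^-∘ a k g) (-‿cong (t∘ g))) ⟩
    -- The lone `g` is expanded to `a T + b`, whose constant term cancels the final `b`.
    const a * g ^ k - g + const b                         ≈⟨ solve 4 (λ a b T G → a ⊗ G ⊕ ⊝ (a ⊗ T ⊕ b) ⊕ b ⊜ a ⊗ (G ⊕ ⊝ T))
                                                               ≈-refl (const a) (const b) (t ^ k) (g ^ k) ⟩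
    const a * (g ^ k - t ^ k)                             ∎

theorem1p5 : (k : ℕ) (k≥2 : k ≥ 2) →
    ((a b : ℤ) → b ≢ 0ℤ →
    AdmitsPolysmoothness (t ^ k + const a * t ^ (k ∸ 1) - const b)
    (φ-ratio (k ∸ 1) {{k≥2⇒k-1≢0 k≥2}}))
    ×
    ((a b : ℤ) → a ℤ.* b ≢ 0ℤ →
    AdmitsPolysmoothness (const a * t ^ k - t + const b)
    (φ-ratio k {{k≥2⇒k≢0 k≥2}}))
theorem1p5 (suc (suc n)) _ =
  t^k+at^[k-1]-b-admits n , λ a b ab≢0 → at^k-t+b-admits n a b λ { refl → ab≢0 refl }
theorem1p5 (suc zero) (s≤s ())
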